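{- Suppose that $\theta$ is a large enough regular cardinal, that $(X,\tau)\in H(\theta)$ is a Rothberger space, and that $\mathbb{P}\in H(\theta)$ is a poset. Suppose further that the set of countable $M\prec H(\theta)$ such that $\mathbb{P}$ is strongly proper for $M$ is stationary in $[H(\theta)]^{\aleph_0}$. Then $\mathbb{P}$ forces that $(X,\tau)$ is Rothberger.
   Context: $H(\theta)$ is the collection of sets hereditarily of cardinality $<\theta$; "large enough" has its usual meaning ($\theta\ge\omega_2$ and $H(\theta)$ contains all relevant objects, such as power sets, topologies, and names built from $\mathbb{P}$ and $X$). Strong properness. Let $M\prec H(\theta)$ be countable with $\mathbb{P}\in M$. For $q\in\mathbb{P}$, a condition $\bar q\in M\cap\mathbb{P}$ is a residue of $q$ to $M$ if every $s\le\bar q$ with $s\in M$ is compatible with $q$. A condition $p\in\mathbb{P}$ is $(M,\mathbb{P})$-strongly generic if every $q\le p$ has a residue to $M$. $\mathbb{P}$ is strongly proper for $M$ if every $s\in M\cap\mathbb{P}$ can be extended to an $(M,\mathbb{P})$-strongly generic condition. Preservation. If $G$ is $V$-generic over $\mathbb{P}$, then $\tau^G$ denotes the topology on $X$ in $V[G]$ having $\tau$ as a basis. "$\mathbb{P}$ forces that $(X,\tau)$ has property $\Phi$" means that every condition forces that $(X,\tau^{\dot G})$ has property $\Phi$. A space $X$ is Rothberger if for every sequence $\langle\mathcal{U}_n:n\in\omega\rangle$ of open covers of $X$ there are $U_n\in\mathcal{U}_n$ such that $X=\bigcup_n U_n$. -}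

-- The universe of sets is Aczel's type of well-founded trees over Set, with
-- bisimilarity as equality.  Excluded middle and the axiom of choice are not
-- assumed here; together with them V is a model of ZFC.
module Defs where

open import Data.Bool using (Bool; T; if_then_else_)
open import Data.Empty using (⊥)
open import Data.Fin using (Fin; zero; suc; #_)
open import Data.Nat using (ℕ; zero; suc)
open import Data.Product using (Σ; ∃; ∃-syntax; _×_; _,_; proj₁; proj₂)
open import Data.Sum using (_⊎_; [_,_])
open import Data.Unit using (⊤)
open import Data.Vec using (Vec; []; _∷_; lookup)
open import Data.Vec.Relation.Unary.All using (All)
open import Function using (_∘_)
open import Function.Bundles using (_⇔_; Injection; Inverse; Func)
open import Level using (Lift; 0ℓ) renaming (suc to lsuc)
open import Relation.Binary.Bundles using (Setoid)
open import Relation.Binary.Definitions using (_Respects_)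
open import Relation.Binary.Structures using (IsPartialOrder)
open import Relation.Nullary using (¬_)

------------------------------------------------------------------------
-- Sets

data V : Set₁ where
  sup : (A : Set) → (A → V) → V

Idx : V → Set
Idx (sup A _) = A

el : (x : V) → Idx x → V
el (sup _ f) = f

infix 4 _≐_ _∈_ _⊆_

_≐_ : V → V → Set
sup A f ≐ sup B g =
  (∀ a → ∃[ b ] f a ≐ g b) × (∀ b → ∃[ a ] f a ≐ g b)

≐-refl : ∀ x → x ≐ x
≐-refl (sup A f) = (λ a → a , ≐-refl (f a)) , (λ a → a , ≐-refl (f a))

≐-sym : ∀ x y → x ≐ y → y ≐ x
≐-sym (sup A f) (sup B g) (l , r) =
    (λ b → proj₁ (r b) , ≐-sym (f (proj₁ (r b))) (g b) (proj₂ (r b)))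
  , (λ a → proj₁ (l a) , ≐-sym (f a) (g (proj₁ (l a))) (proj₂ (l a)))

≐-trans : ∀ x y z → x ≐ y → y ≐ z → x ≐ z
≐-trans (sup A f) (sup B g) (sup C h) (l , r) (l′ , r′) =
    (λ a → let (b , p) = l a ; (c , q) = l′ b in
           c , ≐-trans (f a) (g b) (h c) p q)
  , (λ c → let (b , q) = r′ c ; (a , p) = r b in
           a , ≐-trans (f a) (g b) (h c) p q)

_∈_ : V → V → Set
x ∈ y = ∃[ b ] x ≐ el y b

_⊆_ : V → V → Set₁
x ⊆ y = ∀ z → z ∈ x → z ∈ y

-- A set regarded as the setoid of its elements.  By replacement, functions
-- between sets are the same as setoid functions.
⟦_⟧ : V → Setoid 0ℓ 0ℓ
⟦ x ⟧ = record
  { Carrier       = Idx x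
  ; _≈_           = λ i j → el x i ≐ el x j
  ; isEquivalence = record
      { refl  = λ {i} → ≐-refl (el x i)
      ; sym   = λ {i} {j} → ≐-sym (el x i) (el x j)
      ; trans = λ {i} {j} {k} → ≐-trans (el x i) (el x j) (el x k)
      }
  }

∅ : V
∅ = sup ⊥ (λ ())

｛_,_｝ : V → V → V
｛ x , y ｝ = sup Bool (λ b → if b then x else y)

⟨_,_⟩ : V → V → V
⟨ x , y ⟩ = ｛ ｛ x , x ｝ , ｛ x , y ｝ ｝

⋃ : V → V
⋃ x = sup (Σ (Idx x) (Idx ∘ el x)) (λ (i , j) → el (el x i) j)

infixr 6 _∪_ _∩_ _⊗_

_∪_ : V → V → V
x ∪ y = sup (Idx x ⊎ Idx y) [ el x , el y ]

_∩_ : V → V → V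
x ∩ y = sup (∃[ i ] el x i ∈ y) (el x ∘ proj₁)

_⊗_ : V → V → V
x ⊗ y = sup (Idx x × Idx y) (λ (i , j) → ⟨ el x i , el y j ⟩)

-- Under excluded middle every subset of x is cut out by a Bool-valued function.
𝒫 : V → V
𝒫 x = sup (Idx x → Bool) (λ χ → sup (Σ (Idx x) (T ∘ χ)) (el x ∘ proj₁))

num : ℕ → V
num zero    = ∅
num (suc n) = num n ∪ ｛ num n , num n ｝

ω : V
ω = sup ℕ num

trcl : V → V
trcl (sup A f) = sup A f ∪ ⋃ (sup A (trcl ∘ f))

-- Every family of pairwise disjoint nonempty sets has a transversal.
AxiomOfChoice : Set₁
AxiomOfChoice = ∀ x →
  (∀ y → y ∈ x → ∃[ z ] z ∈ y) →
  (∀ y y′ z → y ∈ x → y′ ∈ x → z ∈ y → z ∈ y′ → y ≐ y′) →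
  ∃[ c ] (∀ y → y ∈ x →
    ∃[ z ] z ∈ y × z ∈ c × (∀ z′ → z′ ∈ y → z′ ∈ c → z′ ≐ z))

------------------------------------------------------------------------
-- Cardinals and H(θ)

infix 4 _≼_ _≺ᶜ_

_≼_ : V → V → Set
x ≼ y = Injection ⟦ x ⟧ ⟦ y ⟧

_≺ᶜ_ : V → V → Set
x ≺ᶜ y = x ≼ y × ¬ (y ≼ x)

IsTransitive : V → Set₁
IsTransitive x = ∀ y z → y ∈ x → z ∈ y → z ∈ x

IsOrdinal : V → Set₁
IsOrdinal x = IsTransitive x × (∀ y → y ∈ x → IsTransitive y)

IsCardinal : V → Set₁
IsCardinal κ = IsOrdinal κ × (∀ α → α ∈ κ → α ≺ᶜ κ)

IsRegular : V → Set₁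
IsRegular κ =
  IsCardinal κ × ω ⊆ κ ×
  (∀ α → α ∈ κ → (f : Func ⟦ α ⟧ ⟦ κ ⟧) →
    ∃[ β ] β ∈ κ × (∀ ξ → el κ (Func.to f ξ) ∈ β))

_IsCardinalSuccessorOf_ : V → V → Set₁
κ IsCardinalSuccessorOf μ =
  IsCardinal κ × μ ∈ κ × (∀ ν → IsCardinal ν → μ ∈ ν → κ ⊆ ν)

ω₂≤_ : V → Set₁
ω₂≤ θ = ∃[ ω₁ ] ∃[ ω₂ ]
  ω₁ IsCardinalSuccessorOf ω × ω₂ IsCardinalSuccessorOf ω₁ × ω₂ ⊆ θ

H : V → V → Set
H θ x = trcl x ≺ᶜ θ

------------------------------------------------------------------------
-- First-order formulas in the language of set theory (de Bruijn indices)

infix  8 _∈′_ _≐′_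
infix  7 ¬′_
infixr 6 _∧′_

private variable n : ℕ

data Formula : ℕ → Set where
  _∈′_ _≐′_ : Fin n → Fin n → Formula n
  ¬′_       : Formula n → Formula n
  _∧′_      : Formula n → Formula n → Formula n
  ∀′        : Formula (suc n) → Formula n

infixr 5 _∨′_
infixr 4 _⇒′_
infix  3 _⇔′_

_∨′_ _⇒′_ _⇔′_ : Formula n → Formula n → Formula n
φ ∨′ ψ = ¬′ (¬′ φ ∧′ ¬′ ψ)
φ ⇒′ ψ = ¬′ (φ ∧′ ¬′ ψ)
φ ⇔′ ψ = (φ ⇒′ ψ) ∧′ (ψ ⇒′ φ)

∃′ : Formula (suc n) → Formula n
∃′ φ = ¬′ ∀′ (¬′ φ)

∀∈ ∃∈ : Fin n → Formula (suc n) → Formula n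
∀∈ x φ = ∀′ (# 0 ∈′ suc x ⇒′ φ)
∃∈ x φ = ∃′ (# 0 ∈′ suc x ∧′ φ)

-- Satisfaction in the ∈-structure whose domain is the class D.
Sat : (V → Set) → ∀ {n} → Formula n → Vec V n → Set₁
Sat D (x ∈′ y) ρ = Lift (lsuc 0ℓ) (lookup ρ x ∈ lookup ρ y)
Sat D (x ≐′ y) ρ = Lift (lsuc 0ℓ) (lookup ρ x ≐ lookup ρ y)
Sat D (¬′ φ)   ρ = ¬ Sat D φ ρ
Sat D (φ ∧′ ψ) ρ = Sat D φ ρ × Sat D ψ ρ
Sat D (∀′ φ)   ρ = ∀ x → D x → Sat D φ (x ∷ ρ)

_≺_ : V → (V → Set) → Set₁
M ≺ D = (∀ x → x ∈ M → D x) ×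
  (∀ {n} (φ : Formula n) (ρ : Vec V n) → All (_∈ M) ρ →
    Sat (_∈ M) φ ρ ⇔ Sat D φ ρ)

------------------------------------------------------------------------
-- The Rothberger property as a first-order formula

infix 8 _⊆′_

_⊆′_ : Fin n → Fin n → Formula n
x ⊆′ y = ∀∈ x (# 0 ∈′ suc y)

-- z = {x , y}
isPair′ : (z x y : Fin n) → Formula n
isPair′ z x y = ∀′ (# 0 ∈′ suc z ⇔′ # 0 ≐′ suc x ∨′ # 0 ≐′ suc y)

-- y = x ∪ {x}
isSucc′ : (y x : Fin n) → Formula n
isSucc′ y x = ∀′ (# 0 ∈′ suc y ⇔′ # 0 ∈′ suc x ∨′ # 0 ≐′ suc x)

isEmpty′ : Fin n → Formula n
isEmpty′ x = ∀′ (¬′ (# 0 ∈′ suc x))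

-- z = ⟨ x , y ⟩; inside, # 1 is {x , x} and # 0 is {x , y}
isOPair′ : (z x y : Fin n) → Formula n
isOPair′ z x y = ∃′ (∃′
  (isPair′ (# 1) (suc (suc x)) (suc (suc x)) ∧′
   isPair′ (# 0) (suc (suc x)) (suc (suc y)) ∧′
   isPair′ (suc (suc z)) (# 1) (# 0)))

isInductive′ : Fin n → Formula n
isInductive′ v =
  ∃∈ v (isEmpty′ (# 0)) ∧′ ∀∈ v (∃∈ (suc v) (isSucc′ (# 0) (# 1)))

-- w is the least inductive set
isω′ : Fin n → Formula n
isω′ w = isInductive′ w ∧′ ∀′ (isInductive′ (# 0) ⇒′ suc w ⊆′ # 0)

-- ⟨ x , y ⟩ ∈ f
app′ : (f x y : Fin n) → Formula n
app′ f x y = ∃∈ f (isOPair′ (# 0) (suc x) (suc y))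

-- u ⊆ t and every point of x lies in a member of u
isOpenCover′ : (u x t : Fin n) → Formula n
isOpenCover′ u x t = u ⊆′ t ∧′ ∀∈ x (∃∈ (suc u) (# 1 ∈′ # 0))

isFunctionOn′ : (f d : Fin n) → Formula n
isFunctionOn′ f d =
  ∀∈ f (∃∈ (suc d) (∃′ (isOPair′ (# 2) (# 1) (# 0)))) ∧′
  ∀∈ d (∃′ (app′ (suc (suc f)) (# 1) (# 0) ∧′
            ∀′ (app′ (suc (suc (suc f))) (# 2) (# 0) ⇒′ # 0 ≐′ # 1)))

-- s is an ω-sequence of open covers of (x , t)
isCoverSequence′ : (s w x t : Fin n) → Formula n
isCoverSequence′ s w x t =
  isFunctionOn′ s w ∧′
  ∀∈ w (∀′ (app′ (suc (suc s)) (# 1) (# 0) ⇒′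
            isOpenCover′ (# 0) (suc (suc x)) (suc (suc t))))

-- f is a function on w with f(k) ∈ s(k) for all k ∈ w, and every point of x
-- belongs to some f(k)
isCoveringSelector′ : (f s w x : Fin n) → Formula n
isCoveringSelector′ f s w x =
  isFunctionOn′ f w ∧′
  ∀∈ w (∀′ (∀′ (app′ (suc (suc (suc f))) (# 2) (# 1) ∧′
                app′ (suc (suc (suc s))) (# 2) (# 0) ⇒′
                # 1 ∈′ # 0))) ∧′
  ∀∈ x (∃∈ (suc w) (∃′ (app′ (suc (suc (suc f))) (# 1) (# 0) ∧′
                        # 2 ∈′ # 0)))

isRothberger′ : (x t : Fin n) → Formula n
isRothberger′ x t =
  ∀′ (isω′ (# 0) ⇒′
  ∀′ (isCoverSequence′ (# 0) (# 1) (suc (suc x)) (suc (suc t)) ⇒′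
  ∃′ (isCoveringSelector′ (# 0) (# 1) (# 2) (suc (suc (suc x))))))

-- t is the topology on x having b as a basis: the set of all u ⊆ x such that
-- every point of u lies in a member of b contained in u
isTopologyWithBasis′ : (t x b : Fin n) → Formula n
isTopologyWithBasis′ t x b =
  ∀′ (# 0 ∈′ suc t ⇔′
      # 0 ⊆′ suc x ∧′
      ∀∈ (# 0) (∃∈ (suc (suc b)) (# 1 ∈′ # 0 ∧′ # 0 ⊆′ # 2)))

-- There is exactly one t as in isTopologyWithBasis′, so ∀′ expresses a definite
-- description.
isRothbergerWithBasis′ : (x b : Fin n) → Formula n
isRothbergerWithBasis′ x b =
  ∀′ (isTopologyWithBasis′ (# 0) (suc x) (suc b) ⇒′ isRothberger′ (suc x) (# 0))

record IsTopology (X τ : V) : Set₁ where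
  field
    open⊆ : ∀ U → U ∈ τ → U ⊆ X
    whole : X ∈ τ
    inter : ∀ U W → U ∈ τ → W ∈ τ → U ∩ W ∈ τ
    union : ∀ 𝒰 → 𝒰 ⊆ τ → ⋃ 𝒰 ∈ τ

IsRothberger : (X τ : V) → Set₁
IsRothberger X τ = Sat (λ _ → ⊤) (isRothberger′ (# 0) (# 1)) (X ∷ τ ∷ [])

------------------------------------------------------------------------
-- Clubs and stationary sets in [A]^ℵ₀

[_]^ℵ₀ : (V → Set) → V → Set₁
[ A ]^ℵ₀ M = (∀ x → x ∈ M → A x) × Inverse ⟦ M ⟧ ⟦ ω ⟧

record IsClub (A : V → Set) (C : V → Set₁) : Set₁ where
  field
    respects  : C Respects _≐_
    countable : ∀ M → C M → [ A ]^ℵ₀ M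
    unbounded : ∀ a → [ A ]^ℵ₀ a → ∃[ M ] C M × a ⊆ M
    closed    : ∀ (M : ℕ → V) → (∀ k → C (M k)) → (∀ k → M k ⊆ M (suc k)) →
                C (⋃ (sup ℕ M))

IsStationary : (V → Set) → (V → Set₁) → Set₂
IsStationary A S = ∀ (C : V → Set₁) → IsClub A C → ∃[ M ] C M × S M

------------------------------------------------------------------------
-- Posets, names and the forcing relation

-- Conditions are represented by indices of elements of ∣P∣.
record PosetV : Set₁ where
  field
    ∣P∣ : V
    leq : V

  Cond : Set
  Cond = Idx ∣P∣

  cond : Cond → V
  cond = el ∣P∣

  infix 4 _≤_
  _≤_ : Cond → Cond → Set
  p ≤ q = ⟨ cond p , cond q ⟩ ∈ leq

  field
    leq⊆           : leq ⊆ ∣P∣ ⊗ ∣P∣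
    isPartialOrder : IsPartialOrder (Setoid._≈_ ⟦ ∣P∣ ⟧) _≤_

  asSet : V
  asSet = ⟨ ∣P∣ , leq ⟩

module Forcing (ℙ : PosetV) where
  open PosetV ℙ public

  Compatible : Cond → Cond → Set
  Compatible p q = ∃[ r ] r ≤ p × r ≤ q

  data Name : Set₁ where
    name : (I : Set) → (I → Name) → (I → Cond) → Name

  -- a name as a set of pairs (name , condition)
  nameSet : Name → V
  nameSet (name I ν c) = sup I (λ i → ⟨ nameSet (ν i) , cond (c i) ⟩)

  -- Since ℙ need not have a largest element, every member is paired with all
  -- conditions.
  check : V → Name
  check (sup A f) = name (A × Cond) (check ∘ f ∘ proj₁) proj₂

  _⊩_≈_ : Cond → Name → Name → Set
  p ⊩ name I ν c ≈ name J μ d =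
    (∀ i q → q ≤ p → q ≤ c i → ∃[ r ] r ≤ q × (∃[ j ] r ≤ d j × r ⊩ ν i ≈ μ j)) ×
    (∀ j q → q ≤ p → q ≤ d j → ∃[ r ] r ≤ q × (∃[ i ] r ≤ c i × r ⊩ ν i ≈ μ j))

  _⊩_∈̇_ : Cond → Name → Name → Set
  p ⊩ a ∈̇ name J μ d =
    ∀ q → q ≤ p → ∃[ r ] r ≤ q × (∃[ j ] r ≤ d j × r ⊩ a ≈ μ j)

  infix 2 _⊩_[_]
  _⊩_[_] : Cond → ∀ {n} → Formula n → Vec Name n → Set₁
  p ⊩ x ∈′ y [ ρ ] = Lift (lsuc 0ℓ) (p ⊩ lookup ρ x ∈̇ lookup ρ y)
  p ⊩ x ≐′ y [ ρ ] = Lift (lsuc 0ℓ) (p ⊩ lookup ρ x ≈ lookup ρ y)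
  p ⊩ ¬′ φ   [ ρ ] = ∀ q → q ≤ p → ¬ (q ⊩ φ [ ρ ])
  p ⊩ φ ∧′ ψ [ ρ ] = (p ⊩ φ [ ρ ]) × (p ⊩ ψ [ ρ ])
  p ⊩ ∀′ φ   [ ρ ] = ∀ a → p ⊩ φ [ a ∷ ρ ]

  ForcesRothberger : (X τ : V) → Set₁
  ForcesRothberger X τ =
    ∀ p → p ⊩ isRothbergerWithBasis′ (# 0) (# 1) [ check X ∷ check τ ∷ [] ]

  IsResidue : (M : V) → Cond → Cond → Set
  IsResidue M q̄ q =
    cond q̄ ∈ M × (∀ s → s ≤ q̄ → cond s ∈ M → Compatible s q)

  IsStronglyGeneric : (M : V) → Cond → Set
  IsStronglyGeneric M p = ∀ q → q ≤ p → ∃[ q̄ ] IsResidue M q̄ q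

  IsStronglyProperFor : V → Set
  IsStronglyProperFor M =
    ∀ s → cond s ∈ M → ∃[ p ] p ≤ s × IsStronglyGeneric M p

-- The subsets of nameSet (check x) are names for the subsets of x, and up to
-- forced equality there are no others; every sequence of families of basic open
-- sets is coded by a subset of ω ⊗ τ.
record IsLargeEnough (θ X τ : V) (ℙ : PosetV) : Set₁ where
  open Forcing ℙ
  field
    ω₂≤θ          : ω₂≤ θ
    points        : H θ (𝒫 X)
    opens         : H θ (𝒫 τ)
    conditions    : H θ (𝒫 ∣P∣)
    subsetNames   : H θ (𝒫 (nameSet (check X)))
    familyNames   : H θ (𝒫 (nameSet (check τ)))
    sequenceNames : H θ (𝒫 (nameSet (check (ω ⊗ τ))))

-- ℙ ∈ M is part of what it means to speak of strong properness for M.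
IsStronglyProperModel : (θ : V) → PosetV → V → Set₁
IsStronglyProperModel θ ℙ M =
  [ H θ ]^ℵ₀ M × M ≺ H θ × PosetV.asSet ℙ ∈ M × Forcing.IsStronglyProperFor ℙ M

{-# OPTIONS --safe #-}

-- Let p force that s is a sequence of open covers.  For a condition q compatible
-- with p, the basic open sets which some r ≤ q forces into a member of s(n) cover
-- X in the ground model.  Splitting ω into infinitely many infinite pieces A_j and
-- applying the Rothberger property to each piece gives, for all n, a condition
-- r(q,n) ≤ q and a basic open set U(q,n), forced by r(q,n) into a member v(q,n) of
-- s(n), such that {U(q,n) : n ∈ A_j} covers X for every j.  Take M closed under r,
-- with an enumeration q_0, q_1, … of ℙ ∩ M, and a strongly generic p′ ≤ p.  In the
-- extension, for n ∈ A_j let f(n) be the first v(q,n) with r(q,n) ∈ G, where q runs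
-- through q_j, q_0, q_1, ….  If q ≤ p′ has residue q_j, then every r(q_j,n) ≤ q_j
-- is compatible with q.  This makes f total, and, choosing n ∈ A_j with x in
-- U(q_j,n), it makes the range of f cover X.
module Submission where

open import Defs
open import Axiom.ExcludedMiddle using (ExcludedMiddle)
open import Data.Bool using (Bool; true; false; if_then_else_)
open import Data.Empty using (⊥-elim)
open import Data.Fin using (Fin; #_; fromℕ<; toℕ)
open import Data.Fin.Properties using (pigeonhole; fromℕ<-injective)
open import Data.Nat using (ℕ; zero; suc)
import Data.Nat as ℕ
open import Data.Nat.Induction using (<-wellFounded)
import Data.Nat.Properties as ℕ
open import Data.Product using (∃; ∃-syntax; _×_; _,_; proj₁; proj₂)
open import Data.Sum using (_⊎_; inj₁; inj₂)
import Data.Sum as Sum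
open import Data.Unit using (⊤; tt)
open import Data.Vec using (Vec; []; _∷_; lookup)
open import Function using (_∘_; id; _⇔_; mk⇔; Equivalence; Inverse)
import Function.Construct.Composition as Compose
open import Induction.WellFounded using (Acc; acc)
open import Level using (Level; Lift; lift; lower; 0ℓ; _⊔_) renaming (suc to lsuc)
open import Relation.Binary.Bundles using (Setoid)
open import Relation.Binary.Definitions using (_Respects_; tri<; tri≈; tri>)
open import Relation.Binary.PropositionalEquality
  using (_≡_; refl; sym; trans; cong; subst)
open import Relation.Binary.Structures using (IsPartialOrder)
open import Relation.Nullary using (¬_; Dec; yes; no; does)
open import Relation.Nullary.Decidable
  using (map′; decidable-stable; dec-true; dec-false; True; toWitness; fromWitness)

open Equivalence using (to; from)

private variable
  ℓ : Level
  n : ℕ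

-- A pairing function on the natural numbers

next : ℕ × ℕ → ℕ × ℕ
next (zero  , n) = suc n , zero
next (suc m , n) = m , suc n

-- Cantor's enumeration of ℕ × ℕ along the antidiagonals.
unpair : ℕ → ℕ × ℕ
unpair zero    = zero , zero
unpair (suc k) = next (unpair k)

unpair-surjective : ∀ m n → ∃[ k ] unpair k ≡ (m , n)
unpair-surjective m n = go (m ℕ.+ n) m n refl
  where
  -- Walk backwards, by induction on the antidiagonal `s` and then on `n`: `(m , suc n)` is preceded
  -- by `(suc m , n)`, and `(suc m , 0)` by `(0 , m)` on the antidiagonal before.
  go : ∀ s m n → m ℕ.+ n ≡ s → ∃[ k ] unpair k ≡ (m , n)
  go s       zero    zero    _ = zero , refl
  go (suc s) (suc m) zero    e =
    let (k , h) = go s zero m (ℕ.suc-injective (trans (cong suc (sym (ℕ.+-identityʳ m))) e))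
    in suc k , cong next h
  go s       m       (suc n) e =
    let (k , h) = go s (suc m) n (trans (sym (ℕ.+-suc m n)) e) in suc k , cong next h

next-injective : ∀ x y → next x ≡ next y → x ≡ y
next-injective (zero  , m) (zero  , .m) refl = refl
next-injective (suc _ , _) (suc _ , _)  refl = refl

unpair-injective : ∀ i j → unpair i ≡ unpair j → i ≡ j
unpair-injective zero    zero    _ = refl
unpair-injective zero    (suc j) e with unpair j
unpair-injective zero    (suc j) () | zero , _
unpair-injective zero    (suc j) () | suc _ , _
unpair-injective (suc i) zero    e with unpair i
unpair-injective (suc i) zero    () | zero , _
unpair-injective (suc i) zero    () | suc _ , _
unpair-injective (suc i) (suc j) e =
  cong suc (unpair-injective i j (next-injective (unpair i) (unpair j) e))

⌜_,_⌝ : ℕ → ℕ → ℕ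
⌜ m , n ⌝ = proj₁ (unpair-surjective m n)

unpair-pair : ∀ m n → unpair ⌜ m , n ⌝ ≡ (m , n)
unpair-pair m n = proj₂ (unpair-surjective m n)

pair-unpair : ∀ k → ⌜ proj₁ (unpair k) , proj₂ (unpair k) ⌝ ≡ k
pair-unpair k = unpair-injective _ k (unpair-pair _ _)

-- Membership, foundation and numerals

∈-respʳ : ∀ {x y z} → y ≐ z → x ∈ y → x ∈ z
∈-respʳ {x} {sup A f} {sup B g} (l , _) (a , x≐fa) =
  let (b , fa≐gb) = l a in b , ≐-trans x (f a) (g b) x≐fa fa≐gb

∈-respˡ : ∀ {x y z} → x ≐ y → x ∈ z → y ∈ z
∈-respˡ {x} {y} {sup A f} x≐y (a , x≐fa) = a , ≐-trans y x (f a) (≐-sym x y x≐y) x≐fa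

el∈ : ∀ x i → el x i ∈ x
el∈ x i = i , ≐-refl (el x i)

-- Foundation, by induction on the tree: a set equal to its own child `f a` passes the
-- self-membership on to `f a`.
∉-self : ∀ x → ¬ x ∈ x
∉-self (sup A f) (a , x≐fa) = ∉-self (f a) (∈-respʳ x≐fa (el∈ (sup A f) a))

num-∈ : ∀ {m n} → m ℕ.< n → num m ∈ num n
num-∈ {m} {suc n} (ℕ.s≤s m≤n) with ℕ.m≤n⇒m<n∨m≡n m≤n
... | inj₁ m<n  = let (i , e) = num-∈ m<n in inj₁ i , e
... | inj₂ refl = inj₂ true , ≐-refl (num m)

num-injective : ∀ {m n} → num m ≐ num n → m ≡ n
num-injective {m} {n} e with ℕ.<-cmp m n
... | tri< m<n _ _ = ⊥-elim (∉-self (num n) (∈-respˡ {z = num n} e (num-∈ m<n)))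
... | tri≈ _ m≡n _ = m≡n
... | tri> _ _ n<m = ⊥-elim (∉-self (num n) (∈-respʳ e (num-∈ n<m)))

-- The features common to the ground model (with a single condition) and to the
-- names of a poset.
record ForcingModel : Set₂ where
  infix 4 _≤_
  field
    Cond     : Set
    _≤_      : Cond → Cond → Set
    ≤-refl   : ∀ {p} → p ≤ p
    ≤-trans  : ∀ {p q r} → p ≤ q → q ≤ r → p ≤ r
    Dom      : Set₁
    mem eq   : Cond → Dom → Dom → Set
    sets     : (I : Set) → (I → Dom) → Dom
    check    : V → Dom

  -- Density below `p`, the forcing reading of existence and disjunction. With a single condition it
  -- is just `P`.
  ◇ : (Cond → Set ℓ) → Cond → Set ℓ
  ◇ P p = ∀ q → q ≤ p → ∃[ r ] r ≤ q × P r

  field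
    mem-mono : ∀ {p q a b} → q ≤ p → mem p a b → mem q a b
    mem-reg  : ∀ {p a b} → ◇ (λ q → mem q a b) p → mem p a b
    mem-cong : ∀ {p a a′ b b′} → eq p a a′ → eq p b b′ → mem p a b → mem p a′ b′
    eq-mono  : ∀ {p q a b} → q ≤ p → eq p a b → eq q a b
    eq-reg   : ∀ {p a b} → ◇ (λ q → eq q a b) p → eq p a b
    eq-refl  : ∀ {p a} → eq p a a
    eq-sym   : ∀ {p a b} → eq p a b → eq p b a
    eq-trans : ∀ {p a b c} → eq p a b → eq p b c → eq p a c
    eq-ext   : ∀ {p a b} →
      (∀ {q} c → q ≤ p → mem q c a → mem q c b) →
      (∀ {q} c → q ≤ p → mem q c b → mem q c a) → eq p a b
    mem-sets : ∀ {p a I f} → mem p a (sets I f) ⇔ ◇ (λ q → ∃[ i ] eq q a (f i)) p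
    mem-check : ∀ x {p a} →
      mem p a (check x) ⇔ ◇ (λ q → ∃[ i ] eq q a (check (el x i))) p

-- Density and the forcing meaning of formulas

module Classical (em : ExcludedMiddle (lsuc 0ℓ)) where

  em₀ : {P : Set} → Dec P
  em₀ = map′ lower (lift {ℓ = lsuc 0ℓ}) em

  byContradiction : {P : Set₁} → ¬ ¬ P → P
  byContradiction = decidable-stable em

  module Semantics (𝔐 : ForcingModel) where
    open ForcingModel 𝔐 public

    private variable
      p q : Cond
      P Q : Cond → Set ℓ

    ◇-intro : (∀ {q} → q ≤ p → P q) → ◇ P p
    ◇-intro h q q≤p = q , ≤-refl , h q≤p

    ◇-mono : q ≤ p → ◇ P p → ◇ P q
    ◇-mono q≤p h r r≤q = h r (≤-trans r≤q q≤p)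

    ◇-bind : ◇ P p → (∀ {q} → q ≤ p → P q → ◇ Q q) → ◇ Q p
    ◇-bind h k q q≤p =
      let (r , r≤q , x)  = h q q≤p
          (s , s≤r , y)  = k (≤-trans r≤q q≤p) x r ≤-refl
      in s , ≤-trans s≤r r≤q , y

    ◇-map : ◇ P p → (∀ {q} → q ≤ p → P q → Q q) → ◇ Q p
    ◇-map h k q q≤p =
      let (r , r≤q , x) = h q q≤p in r , r≤q , k (≤-trans r≤q q≤p) x

    ◇-inhabited : ◇ P p → ∃ P
    ◇-inhabited h = let (r , _ , x) = h _ ≤-refl in r , x

    mem-bind : ∀ {a b} → ◇ P p → (∀ {q} → q ≤ p → P q → mem q a b) → mem p a b
    mem-bind h k = mem-reg (◇-map h k)

    eq-bind : ∀ {a b} → ◇ P p → (∀ {q} → q ≤ p → P q → eq q a b) → eq p a b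
    eq-bind h k = eq-reg (◇-map h k)

    infix 2 _⊩_[_]
    _⊩_[_] : Cond → Formula n → Vec Dom n → Set₁
    p ⊩ x ∈′ y [ ρ ] = Lift (lsuc 0ℓ) (mem p (lookup ρ x) (lookup ρ y))
    p ⊩ x ≐′ y [ ρ ] = Lift (lsuc 0ℓ) (eq p (lookup ρ x) (lookup ρ y))
    p ⊩ ¬′ φ   [ ρ ] = ∀ q → q ≤ p → ¬ (q ⊩ φ [ ρ ])
    p ⊩ φ ∧′ ψ [ ρ ] = (p ⊩ φ [ ρ ]) × (p ⊩ ψ [ ρ ])
    p ⊩ ∀′ φ   [ ρ ] = ∀ a → p ⊩ φ [ a ∷ ρ ]

    ⊩-mono : ∀ (φ : Formula n) {ρ} → q ≤ p → p ⊩ φ [ ρ ] → q ⊩ φ [ ρ ]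
    ⊩-mono (x ∈′ y) q≤p (lift h) = lift (mem-mono q≤p h)
    ⊩-mono (x ≐′ y) q≤p (lift h) = lift (eq-mono q≤p h)
    ⊩-mono (¬′ φ)   q≤p h r r≤q  = h r (≤-trans r≤q q≤p)
    ⊩-mono (φ ∧′ ψ) q≤p (h , k)  = ⊩-mono φ q≤p h , ⊩-mono ψ q≤p k
    ⊩-mono (∀′ φ)   q≤p h a      = ⊩-mono φ q≤p (h a)

    -- Atomic formulas are regular by assumption. For a negation, an extension forcing `φ` would
    -- itself have an extension forcing `¬′ φ`.
    ⊩-reg : ∀ (φ : Formula n) {ρ} → ◇ (_⊩ φ [ ρ ]) p → p ⊩ φ [ ρ ]
    ⊩-reg (x ∈′ y) h = lift (mem-bind h (λ _ → lower))
    ⊩-reg (x ≐′ y) h = lift (eq-bind h (λ _ → lower))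
    ⊩-reg (¬′ φ)   h q q≤p k =
      let (r , r≤q , ¬k) = h q q≤p in ¬k r ≤-refl (⊩-mono φ r≤q k)
    ⊩-reg (φ ∧′ ψ) h =
      ⊩-reg φ (◇-map h (λ _ → proj₁)) , ⊩-reg ψ (◇-map h (λ _ → proj₂))
    ⊩-reg (∀′ φ)   h a = ⊩-reg φ (◇-map h (λ _ k → k a))

    infix 2 _[_]≋_
    -- A direct reading `P` of a formula, valid at every condition. It allows encoded formulas to be
    -- replaced, one connective at a time, by ordinary predicates.
    record _[_]≋_ (φ : Formula n) (ρ : Vec Dom n) (P : Cond → Set ℓ) :
                  Set (lsuc 0ℓ ⊔ ℓ) where
      constructor means
      field
        decode : p ⊩ φ [ ρ ] → P p
        encode : P p → p ⊩ φ [ ρ ]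
    open _[_]≋_ public

    private variable
      φ ψ : Formula n
      ρ   : Vec Dom n

    ≋-map : φ [ ρ ]≋ P → (∀ {p} → P p → Q p) → (∀ {p} → Q p → P p) → φ [ ρ ]≋ Q
    ≋-map m f g = means (λ h → f (decode m h)) (λ h → encode m (g h))

    ∈ᵐ : ∀ {x y : Fin n} {ρ} → x ∈′ y [ ρ ]≋ λ p → mem p (lookup ρ x) (lookup ρ y)
    ∈ᵐ = means lower lift

    ≐ᵐ : ∀ {x y : Fin n} {ρ} → x ≐′ y [ ρ ]≋ λ p → eq p (lookup ρ x) (lookup ρ y)
    ≐ᵐ = means lower lift

    ¬ᵐ : φ [ ρ ]≋ P → ¬′ φ [ ρ ]≋ λ p → ∀ {q} → q ≤ p → ¬ P q
    ¬ᵐ m = means (λ h q≤p k → h _ q≤p (encode m k)) (λ h _ q≤p k → h q≤p (decode m k))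

    ∧ᵐ : φ [ ρ ]≋ P → ψ [ ρ ]≋ Q → φ ∧′ ψ [ ρ ]≋ λ p → P p × Q p
    ∧ᵐ m m′ = means (λ (h , k) → decode m h , decode m′ k)
                    (λ (h , k) → encode m h , encode m′ k)

    ∀ᵐ : {P : Dom → Cond → Set ℓ} →
         (∀ a → φ [ a ∷ ρ ]≋ P a) → ∀′ φ [ ρ ]≋ λ p → ∀ a → P a p
    ∀ᵐ m = means (λ h a → decode (m a) (h a)) (λ h a → encode (m a) (h a))

    -- Since `∃′` abbreviates a negated `∀′`, witnesses appear only densely below the condition;
    -- excluded middle extracts them.
    ∃ᵐ : {P : Dom → Cond → Set ℓ} →
         (∀ a → φ [ a ∷ ρ ]≋ P a) → ∃′ φ [ ρ ]≋ ◇ (λ q → ∃[ a ] P a q)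
    ∃ᵐ m = means
      (λ h q q≤p →
        let (r , r≤q , a , k) = byContradiction (λ ¬k →
              h q q≤p (λ a r r≤q k → ¬k (r , r≤q , a , k)))
        in r , r≤q , a , decode (m a) k)
      (λ h q q≤p k → let (r , r≤q , a , x) = h q q≤p in
                     k a r r≤q (encode (m a) x))

    -- The encoding forbids a condition to force both `φ` and `¬′ ψ`. Below a condition forcing `φ`,
    -- those forcing `ψ` are therefore dense, and `⊩-reg` applies.
    ⇒ᵐ : φ [ ρ ]≋ P → ψ [ ρ ]≋ Q → φ ⇒′ ψ [ ρ ]≋ λ p → ∀ {q} → q ≤ p → P q → Q q
    ⇒ᵐ {φ = φ} {ψ = ψ} m m′ = means
      (λ h q≤p x → decode m′ (⊩-reg ψ λ r r≤q →
        byContradiction λ ¬k → h r (≤-trans r≤q q≤p)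
          ( ⊩-mono φ r≤q (encode m x)
          , λ s s≤r k → ¬k (s , s≤r , k))))
      (λ h q q≤p (k , ¬k) → ¬k q ≤-refl (encode m′ (h q≤p (decode m k))))

    ∨ᵐ : φ [ ρ ]≋ P → ψ [ ρ ]≋ Q → φ ∨′ ψ [ ρ ]≋ ◇ (λ q → P q ⊎ Q q)
    ∨ᵐ m m′ = means
      (λ h q q≤p →
        let (r , r≤q , k) = byContradiction (λ ¬k → h q q≤p
              ( (λ r r≤q k → ¬k (r , r≤q , inj₁ k))
              , (λ r r≤q k → ¬k (r , r≤q , inj₂ k))))
        in r , r≤q , Sum.map (decode m) (decode m′) k)
      (λ h q q≤p (k , k′) → let (r , r≤q , x) = h q q≤p in
        Sum.[ (λ y → k r r≤q (encode m y)) , (λ y → k′ r r≤q (encode m′ y)) ] x)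

    ⇔ᵐ : φ [ ρ ]≋ P → ψ [ ρ ]≋ Q →
         φ ⇔′ ψ [ ρ ]≋ λ p → (∀ {q} → q ≤ p → P q → Q q) × (∀ {q} → q ≤ p → Q q → P q)
    ⇔ᵐ m m′ = ∧ᵐ (⇒ᵐ m m′) (⇒ᵐ m′ m)

    ∀∈ᵐ : ∀ {φ : Formula (suc n)} {x ρ} {P : Dom → Cond → Set ℓ} →
          (∀ a → φ [ a ∷ ρ ]≋ P a) →
          ∀∈ x φ [ ρ ]≋ λ p → ∀ a {q} → q ≤ p → mem q a (lookup ρ x) → P a q
    ∀∈ᵐ m = ∀ᵐ (λ a → ⇒ᵐ ∈ᵐ (m a))

    ∃∈ᵐ : ∀ {φ : Formula (suc n)} {x ρ} {P : Dom → Cond → Set ℓ} →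
          (∀ a → φ [ a ∷ ρ ]≋ P a) →
          ∃∈ x φ [ ρ ]≋ ◇ (λ q → ∃[ a ] mem q a (lookup ρ x) × P a q)
    ∃∈ᵐ m = ∃ᵐ (λ a → ∧ᵐ ∈ᵐ (m a))

    mem-sets-intro : ∀ {I f} i → mem p (f i) (sets I f)
    mem-sets-intro i = from mem-sets (◇-intro λ _ → i , eq-refl)

    -- Check names, pairs and ω

    check-el : ∀ x i → mem p (check (el x i)) (check x)
    check-el x i = from (mem-check x) (◇-intro λ _ → i , eq-refl)

    check-cong : ∀ x y → x ≐ y → eq p (check x) (check y)
    check-cong (sup A f) (sup B g) (l , r) = eq-ext
      (λ c _ h → mem-bind (to (mem-check (sup A f)) h) λ _ (a , e) →
        let (b , fa≐gb) = l a in
        mem-cong (eq-sym (eq-trans e (check-cong (f a) (g b) fa≐gb))) eq-refl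
                 (check-el (sup B g) b))
      (λ c _ h → mem-bind (to (mem-check (sup B g)) h) λ _ (b , e) →
        let (a , fa≐gb) = r b in
        mem-cong (eq-trans (check-cong (f a) (g b) fa≐gb) (eq-sym e)) eq-refl
                 (check-el (sup A f) a))

    -- One condition suffices: below it, density supplies a match for each member, and recursion
    -- assembles these into a bisimulation.
    check-injective : ∀ x y → eq p (check x) (check y) → x ≐ y
    check-injective (sup A f) (sup B g) h =
        (λ a → let (_ , b , e) = ◇-inhabited (to (mem-check (sup B g))
                                   (mem-cong eq-refl h (check-el (sup A f) a)))
               in b , check-injective (f a) (g b) e)
      , (λ b → let (_ , a , e) = ◇-inhabited (to (mem-check (sup A f))
                                   (mem-cong eq-refl (eq-sym h) (check-el (sup B g) b)))
               in a , check-injective (f a) (g b) (eq-sym e))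

    check-∈ : ∀ {x} y → mem p (check x) (check y) → x ∈ y
    check-∈ {x = x} y h = let (_ , i , e) = ◇-inhabited (to (mem-check y) h) in
                          i , check-injective x (el y i) e

    pair : Dom → Dom → Dom
    pair x y = sets Bool (λ b → if b then x else y)

    op : Dom → Dom → Dom
    op x y = pair (pair x x) (pair x y)

    mem-pair : ∀ {a x y} → mem p a (pair x y) ⇔ ◇ (λ q → eq q a x ⊎ eq q a y) p
    mem-pair = mk⇔
      (λ h → ◇-map (to mem-sets h) λ where
        _ (true , e)  → inj₁ e
        _ (false , e) → inj₂ e)
      (λ h → from mem-sets (◇-map h λ where
        _ (inj₁ e) → true , e
        _ (inj₂ e) → false , e))

    mem-pairˡ : ∀ {x y} → mem p x (pair x y)
    mem-pairˡ = mem-sets-intro true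

    mem-pairʳ : ∀ {x y} → mem p y (pair x y)
    mem-pairʳ = mem-sets-intro false

    mem-singleton : ∀ {a x} → mem p a (pair x x) → eq p a x
    mem-singleton h = eq-bind (to mem-pair h) λ _ → Sum.[ id , id ]

    pair-mono : ∀ {x x′ y y′} → eq p x x′ → eq p y y′ →
                ∀ {q} c → q ≤ p → mem q c (pair x y) → mem q c (pair x′ y′)
    pair-mono h k c q≤p m = from mem-pair (◇-map (to mem-pair m) λ r≤q →
      let r≤p = ≤-trans r≤q q≤p in
      Sum.map (λ e → eq-trans e (eq-mono r≤p h)) (λ e → eq-trans e (eq-mono r≤p k)))

    pair-cong : ∀ {x x′ y y′} → eq p x x′ → eq p y y′ → eq p (pair x y) (pair x′ y′)
    pair-cong h k = eq-ext (pair-mono h k) (pair-mono (eq-sym h) (eq-sym k))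

    op-cong : ∀ {x x′ y y′} → eq p x x′ → eq p y y′ → eq p (op x y) (op x′ y′)
    op-cong h k = pair-cong (pair-cong h h) (pair-cong h k)

    singleton-pair : ∀ {x y z} → eq p (pair x x) (pair y z) → eq p x y × eq p x z
    singleton-pair h =
        eq-sym (mem-singleton (mem-cong eq-refl (eq-sym h) mem-pairˡ))
      , eq-sym (mem-singleton (mem-cong eq-refl (eq-sym h) mem-pairʳ))

    pair-injectiveʳ : ∀ {x y y′} → eq p (pair x y) (pair x y′) → eq p y y′
    pair-injectiveʳ h =
      eq-bind (to mem-pair (mem-cong eq-refl h mem-pairʳ)) λ where
        q≤p (inj₂ y≈y′) → y≈y′
        q≤p (inj₁ y≈x)  →
          eq-bind (to mem-pair (mem-cong eq-refl (eq-sym (eq-mono q≤p h)) mem-pairʳ))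
            λ r≤q → Sum.[ (λ y′≈x → eq-trans (eq-mono r≤q y≈x) (eq-sym y′≈x)) , eq-sym ]

    op-injectiveˡ : ∀ {x x′ y y′} → eq p (op x y) (op x′ y′) → eq p x x′
    op-injectiveˡ h = eq-bind (to mem-pair (mem-cong eq-refl h mem-pairˡ)) λ _ →
      Sum.[ (λ e → proj₁ (singleton-pair e)) , (λ e → proj₁ (singleton-pair e)) ]

    -- If `pair x y` matches `pair x′ y′`, cancel the first coordinates. If it matches the singleton
    -- of `x′`, match `pair x′ y′` in turn; should that be the singleton of `x`, all four names
    -- coincide.
    op-injectiveʳ : ∀ {x x′ y y′} → eq p (op x y) (op x′ y′) → eq p y y′
    op-injectiveʳ {x = x} {x′} {y} {y′} h =
      eq-bind (to mem-pair (mem-cong eq-refl h mem-pairʳ)) λ where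
        q≤p (inj₂ e) → pairs q≤p e
        q≤p (inj₁ e) →
          eq-bind (to mem-pair (mem-cong eq-refl (eq-sym (eq-mono q≤p h)) mem-pairʳ))
            λ where
              r≤q (inj₂ e′) → pairs (≤-trans r≤q q≤p) (eq-sym e′)
              r≤q (inj₁ e′) →
                let y≈x′ = eq-mono r≤q (eq-sym (proj₂ (singleton-pair (eq-sym e))))
                    y′≈x = eq-sym (proj₂ (singleton-pair (eq-sym e′)))
                in eq-trans y≈x′ (eq-trans (eq-sym (eq-mono (≤-trans r≤q q≤p) x≈x′))
                                           (eq-sym y′≈x))
      where
      x≈x′ = op-injectiveˡ h
      pairs : ∀ {q} → q ≤ _ → eq q (pair x y) (pair x′ y′) → eq q y y′
      pairs q≤p e =
        pair-injectiveʳ (eq-trans e (pair-cong (eq-sym (eq-mono q≤p x≈x′)) eq-refl))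

    numeral : ℕ → Dom
    numeral = check ∘ num

    ω̇ : Dom
    ω̇ = check ω

    numeral∈ω : ∀ n → mem p (numeral n) ω̇
    numeral∈ω = check-el ω

    mem-suc : ∀ n {a} → mem p a (numeral (suc n)) ⇔
              ◇ (λ q → mem q a (numeral n) ⊎ eq q a (numeral n)) p
    mem-suc n = mk⇔
      (λ h → ◇-map (to (mem-check (num (suc n))) h) λ where
        _ (inj₁ i , e)     → inj₁ (mem-cong (eq-sym e) eq-refl (check-el (num n) i))
        _ (inj₂ true , e)  → inj₂ e
        _ (inj₂ false , e) → inj₂ e)
      (λ h → from (mem-check (num (suc n))) (◇-bind h λ where
        _ (inj₁ m) → ◇-map (to (mem-check (num n)) m) λ _ (i , e) → inj₁ i , e
        _ (inj₂ e) → ◇-intro λ r≤q → inj₂ true , eq-mono r≤q e))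

    Succ : Dom → Dom → Cond → Set₁
    Succ b a p = ∀ c →
      (∀ {q} → q ≤ p → mem q c b → ◇ (λ r → mem r c a ⊎ eq r c a) q) ×
      (∀ {q} → q ≤ p → ◇ (λ r → mem r c a ⊎ eq r c a) q → mem q c b)

    Inductive : Dom → Cond → Set₁
    Inductive v p =
      ◇ (λ q → ∃[ a ] mem q a v × (∀ c {r} → r ≤ q → ¬ mem r c a)) p ×
      (∀ a {q} → q ≤ p → mem q a v → ◇ (λ r → ∃[ b ] mem r b v × Succ b a r) q)

    isEmptyᵐ : ∀ {x : Fin n} {ρ} →
      isEmpty′ x [ ρ ]≋ λ p → ∀ c {q} → q ≤ p → ¬ mem q c (lookup ρ x)
    isEmptyᵐ = ∀ᵐ λ c → ¬ᵐ ∈ᵐ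

    isSuccᵐ : ∀ {y x : Fin n} {ρ} → isSucc′ y x [ ρ ]≋ Succ (lookup ρ y) (lookup ρ x)
    isSuccᵐ = ∀ᵐ λ c → ⇔ᵐ ∈ᵐ (∨ᵐ ∈ᵐ ≐ᵐ)

    isInductiveᵐ : ∀ {v : Fin n} {ρ} → isInductive′ v [ ρ ]≋ Inductive (lookup ρ v)
    isInductiveᵐ = ∧ᵐ (∃∈ᵐ λ _ → isEmptyᵐ) (∀∈ᵐ λ _ → ∃∈ᵐ λ _ → isSuccᵐ)

    ∉numeral-zero : ∀ {c} → ¬ mem p c (numeral 0)
    ∉numeral-zero m = proj₁ (proj₂ (◇-inhabited (to (mem-check ∅) m)))

    empty-unique : ∀ {a} → (∀ c {q} → q ≤ p → ¬ mem q c a) → eq p a (numeral 0)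
    empty-unique h = eq-ext
      (λ c q≤p m → ⊥-elim (h c q≤p m))
      (λ c q≤p m → ⊥-elim (∉numeral-zero m))

    mem-or-eq-cong : ∀ {a a′ c} → eq p a a′ → ◇ (λ r → mem r c a ⊎ eq r c a) p →
                     ◇ (λ r → mem r c a′ ⊎ eq r c a′) p
    mem-or-eq-cong h k = ◇-map k λ q≤p →
      Sum.map (mem-cong eq-refl (eq-mono q≤p h)) (λ e → eq-trans e (eq-mono q≤p h))

    succ-unique : ∀ n {a b} → eq p a (numeral n) → Succ b a p → eq p b (numeral (suc n))
    succ-unique n h s = eq-ext
      (λ c q≤p m → from (mem-suc n) (mem-or-eq-cong (eq-mono q≤p h) (proj₁ (s c) q≤p m)))
      (λ c q≤p m → proj₂ (s c) q≤p
        (mem-or-eq-cong (eq-mono q≤p (eq-sym h)) (to (mem-suc n) m)))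

    succ-numeral : ∀ n {a} → eq p a (numeral n) → Succ (numeral (suc n)) a p
    succ-numeral n h c =
        (λ q≤p m → mem-or-eq-cong (eq-mono q≤p (eq-sym h)) (to (mem-suc n) m))
      , (λ q≤p m → from (mem-suc n) (mem-or-eq-cong (eq-mono q≤p h) m))

    inductive-cong : ∀ {v v′} → eq p v v′ → Inductive v p → Inductive v′ p
    inductive-cong h (z , s) =
        ◇-map z (λ q≤p (a , m , k) → a , mem-cong eq-refl (eq-mono q≤p h) m , k)
      , λ a q≤p m →
          ◇-map (s a q≤p (mem-cong eq-refl (eq-sym (eq-mono q≤p h)) m))
            λ r≤q (b , m′ , k) →
              b , mem-cong eq-refl (eq-mono (≤-trans r≤q q≤p) h) m′ , k

    ω-inductive : Inductive ω̇ p
    ω-inductive =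
        ◇-intro (λ _ → numeral 0 , numeral∈ω 0 , λ c {_} _ → ∉numeral-zero)
      , λ a q≤p m → ◇-map (to (mem-check ω) m) λ _ (n , e) →
          numeral (suc n) , numeral∈ω (suc n) , succ-numeral n e

    ω-least : ∀ {v} → Inductive v p → ∀ n → mem p (numeral n) v
    ω-least (z , s) zero = mem-bind z λ _ (a , m , k) →
      mem-cong (empty-unique k) eq-refl m
    ω-least h@(z , s) (suc n) = mem-bind (s (numeral n) ≤-refl (ω-least h n))
      λ _ (b , m , k) → mem-cong (succ-unique n eq-refl k) eq-refl m

    inductive-mono : ∀ {v} → q ≤ p → Inductive v p → Inductive v q
    inductive-mono q≤p (z , s) = ◇-mono q≤p z , λ a r≤q → s a (≤-trans r≤q q≤p)

    ω⊆inductive : ∀ {v a} → Inductive v p → mem p a ω̇ → mem p a v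
    ω⊆inductive h m = mem-bind (to (mem-check ω) m) λ q≤p (n , e) →
      mem-cong (eq-sym e) eq-refl (ω-least (inductive-mono q≤p h) n)

    -- Absoluteness of ω: `ω̇` is inductive, and every inductive set contains all numerals because
    -- empty sets and successors are unique.
    isωᵐ : ∀ {w : Fin n} {ρ} → isω′ w [ ρ ]≋ λ p → eq p (lookup ρ w) ω̇
    isωᵐ = ≋-map (∧ᵐ isInductiveᵐ (∀ᵐ λ v → ⇒ᵐ isInductiveᵐ (∀∈ᵐ λ a → ∈ᵐ)))
      (λ (i , l) → eq-ext
        (λ c q≤p m → l ω̇ q≤p ω-inductive c ≤-refl m)
        (λ c q≤p m → ω⊆inductive (inductive-mono q≤p i) m))
      (λ h → inductive-cong (eq-sym h) ω-inductive ,
        λ v q≤p i a r≤q m → ω⊆inductive (inductive-mono r≤q i)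
          (mem-cong eq-refl (eq-mono (≤-trans r≤q q≤p) h) m))

    -- Meanings of the formulas of the statement

    isPairᵐ : ∀ {z x y : Fin n} {ρ} →
      isPair′ z x y [ ρ ]≋ λ p → eq p (lookup ρ z) (pair (lookup ρ x) (lookup ρ y))
    isPairᵐ = ≋-map (∀ᵐ λ c → ⇔ᵐ ∈ᵐ (∨ᵐ ≐ᵐ ≐ᵐ))
      (λ h → eq-ext
        (λ c q≤p m → from mem-pair (proj₁ (h c) q≤p m))
        (λ c q≤p m → proj₂ (h c) q≤p (to mem-pair m)))
      (λ h c →
          (λ q≤p m → to mem-pair (mem-cong eq-refl (eq-mono q≤p h) m))
        , (λ q≤p m → mem-cong eq-refl (eq-sym (eq-mono q≤p h)) (from mem-pair m)))

    isOPairᵐ : ∀ {z x y : Fin n} {ρ} →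
      isOPair′ z x y [ ρ ]≋ λ p → eq p (lookup ρ z) (op (lookup ρ x) (lookup ρ y))
    isOPairᵐ = ≋-map (∃ᵐ λ a → ∃ᵐ λ b → ∧ᵐ isPairᵐ (∧ᵐ isPairᵐ isPairᵐ))
      (λ h → eq-bind h λ _ (a , k) → eq-bind k λ _ (b , a≈ , b≈ , z≈) →
        eq-trans z≈ (pair-cong a≈ b≈))
      (λ h → ◇-intro λ q≤p → _ , ◇-intro λ r≤q → _ , eq-refl , eq-refl ,
        eq-mono (≤-trans r≤q q≤p) h)

    appᵐ : ∀ {f x y : Fin n} {ρ} →
      app′ f x y [ ρ ]≋ λ p → mem p (op (lookup ρ x) (lookup ρ y)) (lookup ρ f)
    appᵐ = ≋-map (∃∈ᵐ λ z → isOPairᵐ)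
      (λ h → mem-bind h λ _ (z , m , e) → mem-cong e eq-refl m)
      (λ h → ◇-intro λ q≤p → _ , mem-mono q≤p h , eq-refl)

    Subset : Dom → Dom → Cond → Set₁
    Subset u v p = ∀ a {q} → q ≤ p → mem q a u → mem q a v

    Function : Dom → Dom → Cond → Set₁
    Function f d p =
      (∀ z {q} → q ≤ p → mem q z f →
        ◇ (λ r → ∃[ k ] mem r k d × ◇ (λ s → ∃[ y ] eq s z (op k y)) r) q) ×
      (∀ k {q} → q ≤ p → mem q k d →
        ◇ (λ r → ∃[ y ] mem r (op k y) f ×
                 (∀ y′ {s} → s ≤ r → mem s (op k y′) f → eq s y′ y)) q)

    OpenCover : (u x t : Dom) → Cond → Set₁
    OpenCover u x t p = Subset u t p ×
      (∀ a {q} → q ≤ p → mem q a x → ◇ (λ r → ∃[ v ] mem r v u × mem r a v) q)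

    CoverSequence : (s w x t : Dom) → Cond → Set₁
    CoverSequence s w x t p = Function s w p ×
      (∀ k {q} → q ≤ p → mem q k w →
        ∀ u {r} → r ≤ q → mem r (op k u) s → OpenCover u x t r)

    CoveringSelector : (f s w x : Dom) → Cond → Set₁
    CoveringSelector f s w x p = Function f w p ×
      (∀ k {q} → q ≤ p → mem q k w → ∀ v u {r} → r ≤ q →
        mem r (op k v) f × mem r (op k u) s → mem r v u) ×
      (∀ a {q} → q ≤ p → mem q a x →
        ◇ (λ r → ∃[ k ] mem r k w ×
                 ◇ (λ r′ → ∃[ v ] mem r′ (op k v) f × mem r′ a v) r) q)

    Rothberger : (x t : Dom) → Cond → Set₁
    Rothberger x t p = ∀ w {q} → q ≤ p → eq q w ω̇ →
      ∀ s {r} → r ≤ q → CoverSequence s w x t r →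
      ◇ (λ r′ → ∃[ f ] CoveringSelector f s w x r′) r

    TopologyWithBasis : (t x b : Dom) → Cond → Set₁
    TopologyWithBasis t x b p = ∀ u →
      (∀ {q} → q ≤ p → mem q u t → Open u q) ×
      (∀ {q} → q ≤ p → Open u q → mem q u t)
      where
      Open : Dom → Cond → Set₁
      Open u q = Subset u x q ×
        (∀ a {r} → r ≤ q → mem r a u →
          ◇ (λ r′ → ∃[ c ] mem r′ c b × mem r′ a c × Subset c u r′) r)

    coverSequence-mono : ∀ {s w x t} → q ≤ p →
      CoverSequence s w x t p → CoverSequence s w x t q
    coverSequence-mono q≤p ((f , g) , h) =
        ( (λ z r≤q → f z (≤-trans r≤q q≤p))
        , (λ k r≤q → g k (≤-trans r≤q q≤p)))
      , λ k r≤q → h k (≤-trans r≤q q≤p)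

    topologyWithBasis-mono : ∀ {t x b} → q ≤ p →
      TopologyWithBasis t x b p → TopologyWithBasis t x b q
    topologyWithBasis-mono q≤p h u =
        (λ r≤q → proj₁ (h u) (≤-trans r≤q q≤p))
      , (λ r≤q → proj₂ (h u) (≤-trans r≤q q≤p))

    isFunctionOnᵐ : ∀ {f d : Fin n} {ρ} →
      isFunctionOn′ f d [ ρ ]≋ Function (lookup ρ f) (lookup ρ d)
    isFunctionOnᵐ = ∧ᵐ
      (∀∈ᵐ λ z → ∃∈ᵐ λ k → ∃ᵐ λ y → isOPairᵐ)
      (∀∈ᵐ λ k → ∃ᵐ λ y → ∧ᵐ appᵐ (∀ᵐ λ y′ → ⇒ᵐ appᵐ ≐ᵐ))

    isOpenCoverᵐ : ∀ {u x t : Fin n} {ρ} →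
      isOpenCover′ u x t [ ρ ]≋ OpenCover (lookup ρ u) (lookup ρ x) (lookup ρ t)
    isOpenCoverᵐ = ∧ᵐ (∀∈ᵐ λ _ → ∈ᵐ) (∀∈ᵐ λ a → ∃∈ᵐ λ v → ∈ᵐ)

    isCoverSequenceᵐ : ∀ {s w x t : Fin n} {ρ} →
      isCoverSequence′ s w x t [ ρ ]≋
        CoverSequence (lookup ρ s) (lookup ρ w) (lookup ρ x) (lookup ρ t)
    isCoverSequenceᵐ = ∧ᵐ isFunctionOnᵐ (∀∈ᵐ λ k → ∀ᵐ λ u → ⇒ᵐ appᵐ isOpenCoverᵐ)

    isCoveringSelectorᵐ : ∀ {f s w x : Fin n} {ρ} →
      isCoveringSelector′ f s w x [ ρ ]≋
        CoveringSelector (lookup ρ f) (lookup ρ s) (lookup ρ w) (lookup ρ x)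
    isCoveringSelectorᵐ = ∧ᵐ isFunctionOnᵐ (∧ᵐ
      (∀∈ᵐ λ k → ∀ᵐ λ v → ∀ᵐ λ u → ⇒ᵐ (∧ᵐ appᵐ appᵐ) ∈ᵐ)
      (∀∈ᵐ λ a → ∃∈ᵐ λ k → ∃ᵐ λ v → ∧ᵐ appᵐ ∈ᵐ))

    isRothbergerᵐ : ∀ {x t : Fin n} {ρ} →
      isRothberger′ x t [ ρ ]≋ Rothberger (lookup ρ x) (lookup ρ t)
    isRothbergerᵐ =
      ∀ᵐ λ w → ⇒ᵐ isωᵐ (∀ᵐ λ s → ⇒ᵐ isCoverSequenceᵐ (∃ᵐ λ f → isCoveringSelectorᵐ))

    isTopologyWithBasisᵐ : ∀ {t x b : Fin n} {ρ} →
      isTopologyWithBasis′ t x b [ ρ ]≋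
        TopologyWithBasis (lookup ρ t) (lookup ρ x) (lookup ρ b)
    isTopologyWithBasisᵐ = ∀ᵐ λ u → ⇔ᵐ ∈ᵐ (∧ᵐ (∀∈ᵐ λ _ → ∈ᵐ)
      (∀∈ᵐ λ a → ∃∈ᵐ λ c → ∧ᵐ ∈ᵐ (∀∈ᵐ λ _ → ∈ᵐ)))

    isRothbergerWithBasisᵐ : ∀ {x b : Fin n} {ρ} →
      isRothbergerWithBasis′ x b [ ρ ]≋ λ p →
        ∀ t {q} → q ≤ p → TopologyWithBasis t (lookup ρ x) (lookup ρ b) q →
        Rothberger (lookup ρ x) t q
    isRothbergerWithBasisᵐ = ∀ᵐ λ t → ⇒ᵐ isTopologyWithBasisᵐ isRothbergerᵐ

    -- The cover `v` may change with the condition. This is the situation for a sequence evaluated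
    -- at a name for a natural number, whose value is decided only densely.
    openCover-local : ∀ {u x t} →
      ◇ (λ q → ∃[ v ] eq q u v × OpenCover v x t q) p → OpenCover u x t p
    openCover-local h =
        (λ a q≤p m → mem-bind (◇-mono q≤p h) λ r≤q (v , u≈v , sub , _) →
          sub a ≤-refl (mem-cong eq-refl u≈v (mem-mono r≤q m)))
      , λ a q≤p m → ◇-bind (◇-mono q≤p h) λ r≤q (v , u≈v , _ , cov) →
          ◇-map (cov a ≤-refl (mem-mono r≤q m)) λ s≤r (b , b∈v , a∈b) →
            b , mem-cong eq-refl (eq-sym (eq-mono s≤r u≈v)) b∈v , a∈b

    function-unique : ∀ {f d k y y′} → Function f d p → q ≤ p → mem q k d →
      mem q (op k y) f → mem q (op k y′) f → eq q y y′
    function-unique h q≤p k∈d m m′ = eq-bind (proj₂ h _ q≤p k∈d) λ r≤q (z , _ , unique) →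
      eq-trans (unique _ ≤-refl (mem-mono r≤q m))
               (eq-sym (unique _ ≤-refl (mem-mono r≤q m′)))

    -- Sequences indexed by ω and their selectors

    seq : (ℕ → Dom) → Dom
    seq g = sets ℕ (λ k → op (numeral k) (g k))

    module _ {g : ℕ → Dom} where

      seq-app : ∀ {k y} → mem p (op k y) (seq g) →
                ◇ (λ q → ∃[ i ] eq q k (numeral i) × eq q y (g i)) p
      seq-app m = ◇-map (to mem-sets m) λ _ (i , e) →
        i , op-injectiveˡ e , op-injectiveʳ e

      -- Distinct numerals are never forced equal, so the index `i` found below any condition must
      -- be `k`.
      seq-app-numeral : ∀ k {y} → mem p (op (numeral k) y) (seq g) → eq p y (g k)
      seq-app-numeral k m = eq-bind (seq-app m) λ where
        _ (i , e , e′) → subst (λ j → eq _ _ (g j))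
          (sym (num-injective (check-injective (num k) (num i) e))) e′

      seq-function : ∀ {w} → eq p w ω̇ → Function (seq g) w p
      seq-function h =
          (λ z q≤p m → ◇-map (to mem-sets m) λ r≤q (i , e) →
            numeral i ,
            mem-cong eq-refl (eq-sym (eq-mono (≤-trans r≤q q≤p) h)) (numeral∈ω i) ,
            ◇-intro λ s≤r → g i , eq-mono s≤r e)
        , λ k q≤p m →
            ◇-map (to (mem-check ω) (mem-cong eq-refl (eq-mono q≤p h) m)) λ _ (i , e) →
              g i , mem-cong (op-cong (eq-sym e) eq-refl) eq-refl (mem-sets-intro i) ,
              λ y′ {_} s≤r m′ →
                seq-app-numeral i (mem-cong (op-cong (eq-mono s≤r e) eq-refl) eq-refl m′)

      seq-coverSequence : ∀ {w x t} → eq p w ω̇ →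
        (∀ i {q} → q ≤ p → OpenCover (g i) x t q) → CoverSequence (seq g) w x t p
      seq-coverSequence h cover = seq-function h , λ k q≤p _ u r≤q m →
        openCover-local (◇-map (seq-app m) λ r′≤r (i , _ , e) →
          g i , e , cover i (≤-trans r′≤r (≤-trans r≤q q≤p)))

      seq-selector : ∀ {s w x} → eq p w ω̇ →
        (∀ i u {q} → q ≤ p → mem q (op (numeral i) u) s → mem q (g i) u) →
        (∀ a {q} → q ≤ p → mem q a x → ◇ (λ r → ∃[ i ] mem r a (g i)) q) →
        CoveringSelector (seq g) s w x p
      seq-selector h select cover =
          seq-function h
        , (λ k q≤p _ v u r≤q (m , m′) → mem-bind (seq-app m) λ r′≤r (i , k≈i , v≈gi) →
            mem-cong (eq-sym v≈gi) eq-refl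
              (select i u (≤-trans r′≤r (≤-trans r≤q q≤p))
                (mem-cong (op-cong k≈i eq-refl) eq-refl (mem-mono r′≤r m′))))
        , λ a q≤p m → ◇-map (cover a q≤p m) λ r≤q (i , m′) →
            let r≤p = ≤-trans r≤q q≤p in
            numeral i , mem-cong eq-refl (eq-sym (eq-mono r≤p h)) (numeral∈ω i) ,
            ◇-intro λ r′≤r → g i , mem-sets-intro i , mem-mono r′≤r m′

  -- The ground model

  ∈-ext : ∀ {x y} → (∀ z → z ∈ x → z ∈ y) → (∀ z → z ∈ y → z ∈ x) → x ≐ y
  ∈-ext {x = sup A f} {sup B g} l r =
      (λ a → l (f a) (el∈ (sup A f) a))
    , (λ b → let (a , e) = r (g b) (el∈ (sup B g) b) in a , ≐-sym (g b) (f a) e)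

  universe : ForcingModel
  universe = record
    { Cond     = ⊤
    ; _≤_      = λ _ _ → ⊤
    ; ≤-refl   = tt
    ; ≤-trans  = λ _ _ → tt
    ; Dom      = V
    ; mem      = λ _ → _∈_
    ; eq       = λ _ → _≐_
    ; sets     = sup
    ; check    = id
    ; mem-mono = λ _ m → m
    ; mem-reg  = λ h → proj₂ (proj₂ (h tt tt))
    ; mem-cong = λ {_} {_} {_} {b} e e′ m → ∈-respʳ e′ (∈-respˡ {z = b} e m)
    ; eq-mono  = λ _ e → e
    ; eq-reg   = λ h → proj₂ (proj₂ (h tt tt))
    ; eq-refl  = λ {_} {a} → ≐-refl a
    ; eq-sym   = λ {_} {a} {b} → ≐-sym a b
    ; eq-trans = λ {_} {a} {b} {c} → ≐-trans a b c
    ; eq-ext   = λ l r → ∈-ext (λ z → l z tt) (λ z → r z tt)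
    ; mem-sets = mk⇔ (λ m _ _ → tt , tt , m) (λ h → proj₂ (proj₂ (h tt tt)))
    ; mem-check = λ _ → mk⇔ (λ m _ _ → tt , tt , m) (λ h → proj₂ (proj₂ (h tt tt)))
    }

  module 𝕍 = Semantics universe

  -- With one condition, forcing is satisfaction. The two directions are mutually recursive because
  -- negation swaps them.
  Sat⇒⊩ : ∀ (φ : Formula n) {ρ} → Sat (λ _ → ⊤) φ ρ → tt 𝕍.⊩ φ [ ρ ]
  ⊩⇒Sat : ∀ (φ : Formula n) {ρ} → tt 𝕍.⊩ φ [ ρ ] → Sat (λ _ → ⊤) φ ρ
  Sat⇒⊩ (x ∈′ y) h         = h
  Sat⇒⊩ (x ≐′ y) h         = h
  Sat⇒⊩ (¬′ φ)   h _ _ k   = h (⊩⇒Sat φ k)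
  Sat⇒⊩ (φ ∧′ ψ) (h , k)   = Sat⇒⊩ φ h , Sat⇒⊩ ψ k
  Sat⇒⊩ (∀′ φ)   h x       = Sat⇒⊩ φ (h x tt)
  ⊩⇒Sat (x ∈′ y) h         = h
  ⊩⇒Sat (x ≐′ y) h         = h
  ⊩⇒Sat (¬′ φ)   h k       = h tt tt (Sat⇒⊩ φ k)
  ⊩⇒Sat (φ ∧′ ψ) (h , k)   = ⊩⇒Sat φ h , ⊩⇒Sat ψ k
  ⊩⇒Sat (∀′ φ)   h x _     = ⊩⇒Sat φ (h x)

  -- The indices satisfying `W n` form an open cover `family n`. The selector for this sequence, a
  -- set of ordered pairs, is turned back into a function `U` into the indices of `τ`.
  rothberger-selection : ∀ X τ → IsRothberger X τ →
    (W : ℕ → Idx τ → Set₁) → (∀ n i → ∃[ U ] W n U × el X i ∈ el τ U) →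
    ∃[ U ] (∀ n → W n (U n)) × (∀ i → ∃[ n ] el X i ∈ el τ (U n))
  rothberger-selection X τ roth W covers = U , (λ n → proj₁ (proj₂ (choice n))) , covered
    where
    family : ℕ → V
    -- `True em` brings the `Set₁`-valued predicate down to `Set`, so that it can index a set.
    family n = sup (∃[ U ] True (em {W n U})) (el τ ∘ proj₁)

    family-cover : ∀ n → 𝕍.OpenCover (family n) X τ tt
    family-cover n =
        (λ { a _ ((U , _) , e) → U , e })
      , (λ a _ (i , e) → let (U , w , m) = covers n i in
          𝕍.◇-intro λ _ → el τ U , ((U , fromWitness w) , ≐-refl (el τ U)) ,
            ∈-respˡ {z = el τ U} (≐-sym a (el X i) e) m)

    rothberger : 𝕍.Rothberger X τ tt
    rothberger = 𝕍.decode (𝕍.isRothbergerᵐ {x = # 0} {t = # 1} {ρ = X ∷ τ ∷ []})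
      (Sat⇒⊩ (isRothberger′ (# 0) (# 1)) {X ∷ τ ∷ []} roth)

    sequence : V
    sequence = 𝕍.seq family

    sequence-cover : 𝕍.CoverSequence sequence 𝕍.ω̇ X τ tt
    sequence-cover = 𝕍.seq-coverSequence {g = family} {w = 𝕍.ω̇} {x = X} {t = τ}
      (≐-refl 𝕍.ω̇) λ i _ → family-cover i

    selector : ∃[ f ] 𝕍.CoveringSelector f sequence 𝕍.ω̇ X tt
    selector = proj₂ (𝕍.◇-inhabited
      (rothberger 𝕍.ω̇ tt (≐-refl 𝕍.ω̇) sequence tt sequence-cover))

    f : V
    f = proj₁ selector

    value : ∀ n → ∃[ y ] 𝕍.op (𝕍.numeral n) y ∈ f ×
                         (∀ y′ → 𝕍.op (𝕍.numeral n) y′ ∈ f → y′ ≐ y)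
    value n =
      let (_ , y , m , u) = 𝕍.◇-inhabited
            (proj₂ (proj₁ (proj₂ selector)) (𝕍.numeral n) tt (𝕍.numeral∈ω {tt} n))
      in y , m , λ y′ → u y′ tt

    choice : ∀ n → ∃[ U ] W n U × proj₁ (value n) ≐ el τ U
    choice n =
      let (y , m , _) = value n
          ((U , w) , e) = proj₁ (proj₂ (proj₂ selector)) (𝕍.numeral n) tt
            (𝕍.numeral∈ω {tt} n) y (family n) tt (m , 𝕍.mem-sets-intro {tt} n)
      in U , toWitness w , e

    U : ℕ → Idx τ
    U n = proj₁ (choice n)

    covered : ∀ i → ∃[ n ] el X i ∈ el τ (U n)
    covered i =
      let (_ , k , (n , k≈n) , h) = 𝕍.◇-inhabited
            (proj₂ (proj₂ (proj₂ selector)) (el X i) tt (el∈ X i))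
          (_ , v , m , x∈v) = 𝕍.◇-inhabited h
          (y , _ , unique)  = value n
          v≐y = unique v (∈-respˡ {z = f}
                  (𝕍.op-cong {tt} {k} {𝕍.numeral n} {v} {v} k≈n (≐-refl v)) m)
      in n , ∈-respʳ (≐-trans v y (el τ (U n)) v≐y (proj₂ (proj₂ (choice n)))) x∈v

  -- The piece `A_j` consists of the `n` with `proj₁ (unpair n) ≡ j`. The selection is made on each
  -- piece separately and glued along `unpair`.
  rothberger-selection-split : ∀ X τ → IsRothberger X τ →
    (W : ℕ → Idx τ → Set₁) → (∀ n i → ∃[ U ] W n U × el X i ∈ el τ U) →
    ∃[ U ] (∀ n → W n (U n)) ×
           (∀ j i → ∃[ n ] proj₁ (unpair n) ≡ j × el X i ∈ el τ (U n))
  rothberger-selection-split X τ roth W covers =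
      (λ n → U (unpair n))
    , (λ n → subst (λ k → W k (U (unpair n))) (pair-unpair n)
               (proj₁ (proj₂ (row (proj₁ (unpair n)))) (proj₂ (unpair n))))
    , λ j i → let (m , x∈U) = proj₂ (proj₂ (row j)) i in
        ⌜ j , m ⌝ , cong proj₁ (unpair-pair j m) ,
        subst (λ k → el X i ∈ el τ (U k)) (sym (unpair-pair j m)) x∈U
    where
    row : ∀ j → ∃[ U ] (∀ m → W ⌜ j , m ⌝ (U m)) × (∀ i → ∃[ m ] el X i ∈ el τ (U m))
    row j = rothberger-selection X τ roth (λ m → W ⌜ j , m ⌝) (λ m → covers ⌜ j , m ⌝)

    U : ℕ × ℕ → Idx τ
    U (j , m) = proj₁ (row j) m

  least : {P : ℕ → Set} → ∃ P → ∃[ n ] P n × (∀ {m} → m ℕ.< n → ¬ P m)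
  least {P} (n , x) = go n (<-wellFounded n) x
    where
    go : ∀ n → Acc ℕ._<_ n → P n → ∃[ n ] P n × (∀ {m} → m ℕ.< n → ¬ P m)
    go n (acc rec) x with em₀ {∃[ m ] m ℕ.< n × P m}
    ... | yes (m , m<n , y) = go m (rec m<n) y
    ... | no ¬∃             = n , x , λ m<n y → ¬∃ (_ , m<n , y)

  -- The covering selector in the extension

  module GenericSelection (𝔐 : ForcingModel) where
    open Semantics 𝔐

    module Selector
      -- Mixing of names: the sets `A i` are downward closed and mutually exclusive, and one name
      -- `g` agrees with `v i` on `A i`.
      (mix : ∀ {I : Set} (v : I → Dom) (A : I → Cond → Set) →
             (∀ {i c d} → d ≤ c → A i c → A i d) →
             (∀ {i j c} → A i c → A j c → i ≡ j) →
             ∃[ g ] (∀ {i c} → A i c → eq c g (v i)))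
      {X τ : V} (rothberger : IsRothberger X τ)
      {p : Cond} {t w s : Dom}
      (basis : TopologyWithBasis t (check X) (check τ) p)
      (w≈ω : eq p w ω̇)
      (sequence : CoverSequence s w (check X) t p)
      where

      Compatible : Cond → Cond → Set
      Compatible q r = ∃[ c ] c ≤ q × c ≤ r

      -- The name `u` of the `n`-th cover is stored because it depends on `r`; `function-unique`
      -- later identifies it with any other name of that cover.
      record Hit (n : ℕ) (U : Idx τ) (r : Cond) : Set₁ where
        field
          {u v} : Dom
          su    : mem r (op (numeral n) u) s
          v∈u   : mem r v u
          U⊆v   : Subset (check (el τ U)) v r

      numeral∈w : ∀ n {q} → q ≤ p → mem q (numeral n) w
      numeral∈w n q≤p = mem-cong eq-refl (eq-sym (eq-mono q≤p w≈ω)) (numeral∈ω n)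

      -- Extend in turn to fix the cover `u`, a member `v` containing the point, a basic set `b`
      -- inside `v` around the point, and the index `U` of `b` in `τ`. That the point lies in `U` is
      -- then a fact of the ground model by `check-∈`.
      hits-dense : ∀ n i {q} → q ≤ p → ◇ (λ r → ∃[ U ] Hit n U r × el X i ∈ el τ U) q
      hits-dense n i q≤p =
        ◇-bind (proj₂ (proj₁ sequence) (numeral n) q≤p (numeral∈w n q≤p)) λ l₁ (u , su , _) →
        let q₁≤p        = ≤-trans l₁ q≤p
            (u⊆t , cov) = proj₂ sequence (numeral n) q≤p (numeral∈w n q≤p) u l₁ su
        in ◇-bind (cov (check (el X i)) ≤-refl (check-el X i)) λ l₂ (v , v∈u , x∈v) →
        let open-v = proj₁ (basis v) (≤-trans l₂ q₁≤p) (u⊆t v l₂ v∈u) in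
        ◇-bind (proj₂ open-v (check (el X i)) ≤-refl x∈v) λ l₃ (b , b∈τ , x∈b , b⊆v) →
        ◇-map (to (mem-check τ) b∈τ) λ l₄ (U , b≈U) →
          U
          , record
            { su    = mem-mono (≤-trans l₄ (≤-trans l₃ l₂)) su
            ; v∈u   = mem-mono (≤-trans l₄ l₃) v∈u
            ; U⊆v   = λ a l₅ m → b⊆v a (≤-trans l₅ l₄)
                        (mem-cong eq-refl (eq-sym (eq-mono l₅ b≈U)) m)
            }
          , check-∈ (el τ U) (mem-cong eq-refl b≈U (mem-mono l₄ x∈b))

      -- Compatibility with `p` is asked instead of lying below `p`, since this is all that a
      -- residue of a condition below `p` is known to satisfy.
      Start : Set
      Start = ∃[ q ] Compatible q p

      -- In the notation of the overview, `chosen n` is U(q,n), `answer n` is r(q,n), and the `v`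
      -- stored in `hit n` is v(q,n).
      record Guess (q : Cond) : Set₁ where
        field
          chosen  : ℕ → Idx τ
          answer  : ℕ → Cond
          answer≤ : ∀ n → answer n ≤ q
          hit     : ∀ n → Hit n (chosen n) (answer n)
          cover   : ∀ j i → ∃[ n ] proj₁ (unpair n) ≡ j × el X i ∈ el τ (chosen n)

      abstract
        guess : (σ : Start) → Guess (proj₁ σ)
        guess (q , c , c≤q , c≤p) =
          let (U , good , cover) = rothberger-selection-split X τ rothberger
                (λ n U → ∃[ r ] r ≤ q × Hit n U r)
                -- Hits are dense only below `p`, so they are sought below the common extension `c`
                -- of `q` and `p`.
                λ n i → let (r , r≤c , U , h , x∈U) = hits-dense n i c≤p c ≤-refl in
                        U , (r , ≤-trans r≤c c≤q , h) , x∈U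
          in record
            { chosen  = U
            ; answer  = λ n → proj₁ (good n)
            ; answer≤ = λ n → proj₁ (proj₂ (good n))
            ; hit     = λ n → proj₂ (proj₂ (good n))
            ; cover   = cover
            }

      open module G (σ : Start) = Guess (guess σ) public

      module _ (σ : ℕ → Start) {p′ : Cond} (p′≤p : p′ ≤ p)
        -- The form in which strong genericity enters. The index `i` does not depend on `n`, so `n`
        -- may be chosen after `i`.
        (predense : ∀ {q} → q ≤ p′ → ∃[ i ] (∀ n → Compatible q (answer (σ i) n))) where

        -- For `n` in `A_j` the start `σ j` goes first. The whole list follows, shifted by one, so
        -- that some attempt succeeds at every `n`.
        attempt : ℕ → ℕ → Start
        attempt n zero    = σ (proj₁ (unpair n))
        attempt n (suc i) = σ i

        -- c forces that i is least with  answer (attempt n i) n  in the generic filter.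
        First : ℕ → ℕ → Cond → Set
        First n i c = c ≤ answer (attempt n i) n ×
                      (∀ {j} → j ℕ.< i → ¬ Compatible c (answer (attempt n j) n))

        First-mono : ∀ {n i c d} → d ≤ c → First n i c → First n i d
        First-mono d≤c (l , k) =
          ≤-trans d≤c l , λ j<i (e , e≤d , l′) → k j<i (e , ≤-trans e≤d d≤c , l′)

        First-unique : ∀ {n i j c} → First n i c → First n j c → i ≡ j
        First-unique {i = i} {j} (l , k) (l′ , k′) with ℕ.<-cmp i j
        ... | tri< i<j _ _ = ⊥-elim (k′ i<j (_ , ≤-refl , l))
        ... | tri≈ _ i≡j _ = i≡j
        ... | tri> _ _ j<i = ⊥-elim (k j<i (_ , ≤-refl , l′))

        First-dense : ∀ n {q} → q ≤ p′ → ◇ (λ c → ∃[ i ] First n i c) q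
        First-dense n q≤p′ r r≤q =
          let (i , compatible)          = predense (≤-trans r≤q q≤p′)
              -- Attempts before the least compatible one are incompatible with `r`, hence with `c`.
              -- The place of `σ i` among the attempts is `suc i`.
              (k , (c , c≤r , l) , min) = least {λ k → Compatible r (answer (attempt n k) n)}
                                                (suc i , compatible n)
          in c , c≤r , k , l , λ j<k (d , d≤c , l′) → min j<k (d , ≤-trans d≤c c≤r , l′)

        value : ∀ n → ∃[ g ] (∀ {i c} → First n i c → eq c g (Hit.v (hit (attempt n i) n)))
        value n = mix (λ i → Hit.v (hit (attempt n i) n)) (First n)
                      (First-mono {n}) (First-unique {n})

        selects : ∀ n u {q} → q ≤ p′ → mem q (op (numeral n) u) s → mem q (proj₁ (value n)) u
        selects n u q≤p′ m = mem-bind (First-dense n q≤p′) λ c≤q (i , first) →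
          let open Hit (hit (attempt n i) n) using (su; v∈u)
              c≤p = ≤-trans c≤q (≤-trans q≤p′ p′≤p)
          in mem-cong (eq-sym (proj₂ (value n) first))
               (function-unique (proj₁ sequence) c≤p (numeral∈w n c≤p)
                 (mem-mono (proj₁ first) su) (mem-mono c≤q m))
               (mem-mono (proj₁ first) v∈u)

        covers : ∀ a {q} → q ≤ p′ → mem q a (check X) →
                 ◇ (λ r → ∃[ n ] mem r a (proj₁ (value n))) q
        covers a q≤p′ m = ◇-bind (to (mem-check X) m) λ q₁≤q (i , a≈i) r r≤q₁ →
          let (j , compatible)     = predense (≤-trans r≤q₁ (≤-trans q₁≤q q≤p′))
              -- Only now is `n` chosen, inside the piece on which `σ j` is tried first.
              (n , n∈Aⱼ , x∈U)     = cover (σ j) j i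
              (c , c≤r , c≤answer) = compatible n
          in c , c≤r , n ,
             mem-cong (eq-sym (eq-mono (≤-trans c≤r r≤q₁) a≈i)) eq-refl
               (in-value n j i n∈Aⱼ x∈U c≤answer)
          where
          in-value : ∀ n j i {c} → proj₁ (unpair n) ≡ j → el X i ∈ el τ (chosen (σ j) n) →
                     c ≤ answer (σ j) n → mem c (check (el X i)) (proj₁ (value n))
          -- Matching `refl` makes `attempt n 0` compute to `σ j`. No attempt precedes number `0`,
          -- so lying below its answer already gives `First`.
          in-value n .(proj₁ (unpair n)) i refl (b , x≐b) c≤answer =
            mem-cong eq-refl (eq-sym (proj₂ (value n) {0} (c≤answer , λ ())))
              (Hit.U⊆v (hit (attempt n 0) n) _ c≤answer
                (mem-cong (eq-sym (check-cong _ _ x≐b)) eq-refl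
                  (check-el (el τ (chosen (attempt n 0) n)) b)))

        covering-selector : ∃[ f ] CoveringSelector f s w (check X) p′
        covering-selector = seq (proj₁ ∘ value) ,
          seq-selector (eq-mono p′≤p w≈ω) selects covers

  -- Names of a poset

  module Names (ℙ : PosetV) where
    open Forcing ℙ hiding (_⊩_[_]; check)
    private module ≤ = IsPartialOrder isPartialOrder

    private variable
      p q : Cond

    ≈-refl : ∀ a → p ⊩ a ≈ a
    ≈-refl (name I ν c) =
        (λ i q _ q≤c → q , ≤.refl , i , q≤c , ≈-refl (ν i))
      , (λ i q _ q≤c → q , ≤.refl , i , q≤c , ≈-refl (ν i))

    ≈-sym : ∀ a b → p ⊩ a ≈ b → p ⊩ b ≈ a
    ≈-sym (name I ν c) (name J μ d) (h , k) =
        (λ j q q≤p q≤d → let (r , r≤q , i , r≤c , e) = k j q q≤p q≤d in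
           r , r≤q , i , r≤c , ≈-sym (ν i) (μ j) e)
      , (λ i q q≤p q≤c → let (r , r≤q , j , r≤d , e) = h i q q≤p q≤c in
           r , r≤q , j , r≤d , ≈-sym (ν i) (μ j) e)

    ≈-mono : ∀ a b → q ≤ p → p ⊩ a ≈ b → q ⊩ a ≈ b
    ≈-mono (name I ν c) (name J μ d) q≤p (h , k) =
        (λ i r r≤q → h i r (≤.trans r≤q q≤p))
      , (λ j r r≤q → k j r (≤.trans r≤q q≤p))

    ≈-trans : ∀ a b c → p ⊩ a ≈ b → p ⊩ b ≈ c → p ⊩ a ≈ c
    ≈-trans (name I ν c) (name J μ d) (name K κ e) (h , k) (h′ , k′) =
        (λ i q q≤p q≤c →
          let (r , r≤q , j , r≤d , x) = h i q q≤p q≤c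
              (s , s≤r , l , s≤e , y) = h′ j r (≤.trans r≤q q≤p) r≤d
          in s , ≤.trans s≤r r≤q , l , s≤e ,
             ≈-trans (ν i) (μ j) (κ l) (≈-mono (ν i) (μ j) s≤r x) y)
      , (λ l q q≤p q≤e →
          let (r , r≤q , j , r≤d , y) = k′ l q q≤p q≤e
              (s , s≤r , i , s≤c , x) = k j r (≤.trans r≤q q≤p) r≤d
          in s , ≤.trans s≤r r≤q , i , s≤c ,
             ≈-trans (ν i) (μ j) (κ l) x (≈-mono (μ j) (κ l) s≤r y))

    ≈-reg : ∀ a b → (∀ q → q ≤ p → ∃[ r ] r ≤ q × r ⊩ a ≈ b) → p ⊩ a ≈ b
    ≈-reg (name I ν c) (name J μ d) h =
        (λ i q q≤p q≤c →
          let (r , r≤q , l , _)  = h q q≤p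
              (s , s≤r , x)      = l i r ≤.refl (≤.trans r≤q q≤c)
          in s , ≤.trans s≤r r≤q , x)
      , (λ j q q≤p q≤d →
          let (r , r≤q , _ , l)  = h q q≤p
              (s , s≤r , x)      = l j r ≤.refl (≤.trans r≤q q≤d)
          in s , ≤.trans s≤r r≤q , x)

    ∈̇-mono : ∀ a b → q ≤ p → p ⊩ a ∈̇ b → q ⊩ a ∈̇ b
    ∈̇-mono a (name J μ d) q≤p h r r≤q = h r (≤.trans r≤q q≤p)

    ∈̇-reg : ∀ a b → (∀ q → q ≤ p → ∃[ r ] r ≤ q × r ⊩ a ∈̇ b) → p ⊩ a ∈̇ b
    ∈̇-reg a (name J μ d) h q q≤p =
      let (r , r≤q , k) = h q q≤p
          (s , s≤r , x) = k r ≤.refl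
      in s , ≤.trans s≤r r≤q , x

    ∈̇-cong : ∀ a a′ b b′ → p ⊩ a ≈ a′ → p ⊩ b ≈ b′ → p ⊩ a ∈̇ b → p ⊩ a′ ∈̇ b′
    ∈̇-cong a a′ (name J μ d) (name K κ e) a≈a′ (h , _) m q q≤p =
      let (r , r≤q , j , r≤d , x) = m q q≤p
          (s , s≤r , l , s≤e , y) = h j r (≤.trans r≤q q≤p) r≤d
          s≤q = ≤.trans s≤r r≤q
      in s , s≤q , l , s≤e ,
         ≈-trans a′ a (κ l) (≈-sym a a′ (≈-mono a a′ (≤.trans s≤q q≤p) a≈a′))
           (≈-trans a (μ j) (κ l) (≈-mono a (μ j) s≤r x) y)

    entry-∈̇ : ∀ {I ν c} (i : I) → p ≤ c i → p ⊩ ν i ∈̇ name I ν c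
    entry-∈̇ {ν = ν} i p≤c q q≤p = q , ≤.refl , i , ≤.trans q≤p p≤c , ≈-refl (ν i)

    ≈-ext : ∀ a b →
      (∀ {q} c → q ≤ p → q ⊩ c ∈̇ a → q ⊩ c ∈̇ b) →
      (∀ {q} c → q ≤ p → q ⊩ c ∈̇ b → q ⊩ c ∈̇ a) → p ⊩ a ≈ b
    ≈-ext (name I ν c) (name J μ d) l r =
        (λ i q q≤p q≤c → l (ν i) q≤p (entry-∈̇ i q≤c) q ≤.refl)
      , (λ j q q≤p q≤d →
          let (s , s≤q , i , s≤c , e) = r (μ j) q≤p (entry-∈̇ j q≤d) q ≤.refl in
          s , s≤q , i , s≤c , ≈-sym (μ j) (ν i) e)

    -- Pairing with every condition replaces pairing with a largest one, which `ℙ` may lack. The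
    -- name `check (sup A f)` has exactly this form.
    everywhere : (I : Set) → (I → Name) → Name
    everywhere I f = name (I × Cond) (f ∘ proj₁) proj₂

    ∈̇-everywhere : ∀ a (I : Set) f → p ⊩ a ∈̇ everywhere I f ⇔
      (∀ q → q ≤ p → ∃[ r ] r ≤ q × ∃[ i ] r ⊩ a ≈ f i)
    ∈̇-everywhere {p} a I f = mk⇔ elim intro
      where
      Somewhere : Cond → Set
      Somewhere p = ∀ q → q ≤ p → ∃[ r ] r ≤ q × ∃[ i ] r ⊩ a ≈ f i

      elim : p ⊩ a ∈̇ everywhere I f → Somewhere p
      elim h q q≤p = let (r , r≤q , (i , _) , _ , e) = h q q≤p in r , r≤q , i , e

      intro : Somewhere p → p ⊩ a ∈̇ everywhere I f
      intro h q q≤p = let (r , r≤q , i , e) = h q q≤p in r , r≤q , (i , r) , ≤.refl , e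

    model : ForcingModel
    model = record
      { Cond      = Cond
      ; _≤_       = _≤_
      ; ≤-refl    = ≤.refl
      ; ≤-trans   = ≤.trans
      ; Dom       = Name
      ; mem       = _⊩_∈̇_
      ; eq        = _⊩_≈_
      ; sets      = everywhere
      ; check     = Forcing.check ℙ
      ; mem-mono  = λ {_} {_} {a} {b} → ∈̇-mono a b
      ; mem-reg   = λ {_} {a} {b} → ∈̇-reg a b
      ; mem-cong  = λ {_} {a} {a′} {b} {b′} → ∈̇-cong a a′ b b′
      ; eq-mono   = λ {_} {_} {a} {b} → ≈-mono a b
      ; eq-reg    = λ {_} {a} {b} → ≈-reg a b
      ; eq-refl   = λ {_} {a} → ≈-refl a
      ; eq-sym    = λ {_} {a} {b} → ≈-sym a b
      ; eq-trans  = λ {_} {a} {b} {c} → ≈-trans a b c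
      ; eq-ext    = λ {_} {a} {b} → ≈-ext a b
      ; mem-sets  = λ {_} {a} {I} {f} → ∈̇-everywhere a I f
      ; mem-check = λ where (sup A f) {_} {a} → ∈̇-everywhere a A (Forcing.check ℙ ∘ f)
      }

    private module M = Semantics model

    forces⇒⊩ : ∀ (φ : Formula n) {ρ} → Forcing._⊩_[_] ℙ p φ ρ → p M.⊩ φ [ ρ ]
    ⊩⇒forces : ∀ (φ : Formula n) {ρ} → p M.⊩ φ [ ρ ] → Forcing._⊩_[_] ℙ p φ ρ
    forces⇒⊩ (x ∈′ y) h         = h
    forces⇒⊩ (x ≐′ y) h         = h
    forces⇒⊩ (¬′ φ)   h q q≤p k = h q q≤p (⊩⇒forces φ k)
    forces⇒⊩ (φ ∧′ ψ) (h , k)   = forces⇒⊩ φ h , forces⇒⊩ ψ k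
    forces⇒⊩ (∀′ φ)   h a       = forces⇒⊩ φ (h a)
    ⊩⇒forces (x ∈′ y) h         = h
    ⊩⇒forces (x ≐′ y) h         = h
    ⊩⇒forces (¬′ φ)   h q q≤p k = h q q≤p (forces⇒⊩ φ k)
    ⊩⇒forces (φ ∧′ ψ) (h , k)   = ⊩⇒forces φ h , ⊩⇒forces ψ k
    ⊩⇒forces (∀′ φ)   h a       = ⊩⇒forces φ (h a)

    -- Gives access to the entries of a name that is not in constructor form, such as `v i` in
    -- `mixing`.
    record Entries (b : Name) : Set₁ where
      field
        Entry     : Set
        entry     : Entry → Name
        condition : Entry → Cond
        ∈̇-entry   : ∀ {p} a → p ⊩ a ∈̇ b ⇔ (∀ q → q ≤ p → ∃[ r ] r ≤ q ×
          (∃[ i ] r ≤ condition i × r ⊩ a ≈ entry i))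

    abstract
      entries : ∀ b → Entries b
      entries (name I ν c) = record
        { Entry     = I
        ; entry     = ν
        ; condition = c
        ; ∈̇-entry   = λ _ → mk⇔ id id
        }

    -- Collect every entry of every `v i`, attached to those conditions of `A i` that lie below the
    -- condition of the entry. Below a condition in `A i`, monotonicity and `unique` rule out
    -- entries from any other index.
    mixing : ∀ {I : Set} (v : I → Name) (A : I → Cond → Set) →
      (∀ {i c d} → d ≤ c → A i c → A i d) →
      (∀ {i j c} → A i c → A j c → i ≡ j) →
      ∃[ g ] (∀ {i c} → A i c → c ⊩ g ≈ v i)
    mixing {I} v A mono unique = name Piece part below , equal
      where
      open module E (i : I) = Entries (entries (v i))

      Piece : Set
      Piece = ∃[ i ] ∃[ m ] ∃[ c ] A i c × c ≤ condition i m

      part : Piece → Name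
      part (i , m , _) = entry i m

      below : Piece → Cond
      below (_ , _ , c , _) = c

      equal : ∀ {i c} → A i c → c ⊩ name Piece part below ≈ v i
      equal {i} {c} a = ≈-ext (name Piece part below) (v i)
        (λ b q≤c h → from (∈̇-entry i b) λ r r≤q →
          let (s , s≤r , (j , m , d , a′ , d≤) , s≤d , e) = h r r≤q in
          s , s≤r , transport b m
            (unique (mono s≤d a′) (mono (≤.trans (≤.trans s≤r r≤q) q≤c) a))
            (≤.trans s≤d d≤) e)
        (λ b q≤c h r r≤q →
          let (s , s≤r , m , s≤d , e) = to (∈̇-entry i b) h r r≤q in
          s , s≤r , (i , m , s , mono (≤.trans (≤.trans s≤r r≤q) q≤c) a , s≤d) , ≤.refl , e)
        where
        transport : ∀ b {j s} (m : Entry j) → j ≡ i →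
          s ≤ condition j m → s ⊩ b ≈ entry j m →
          ∃[ m ] s ≤ condition i m × s ⊩ b ≈ entry i m
        transport b m refl s≤ e = m , s≤ , e

  -- Countable sets and clubs

  module _ (S : Setoid 0ℓ 0ℓ) where
    open Setoid S using (Carrier; _≈_; reflexive)

    module _
      (e : ℕ → Carrier) (e-surjective : ∀ x → ∃[ n ] e n ≈ x)
      (g : ℕ → Carrier) (g-injective : ∀ {m n} → g m ≈ g n → m ≡ n) where

      private
        index : ∀ x → ∃[ n ] e n ≈ x × (∀ {m} → m ℕ.< n → ¬ e m ≈ x)
        index x = least (e-surjective x)

        rank : Carrier → ℕ
        rank x = proj₁ (index x)

        rank-unique : ∀ {x y} → x ≈ y → rank x ≡ rank y
        rank-unique {x} {y} x≈y with ℕ.<-cmp (rank x) (rank y)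
        ... | tri< l _ _ = ⊥-elim (proj₂ (proj₂ (index y)) l
                             (Setoid.trans S (proj₁ (proj₂ (index x))) x≈y))
        ... | tri≈ _ h _ = h
        ... | tri> _ _ l = ⊥-elim (proj₂ (proj₂ (index x)) l
                             (Setoid.trans S (proj₁ (proj₂ (index y))) (Setoid.sym S x≈y)))

        -- `n` is the first place where the element `e n` occurs in the enumeration.
        New : ℕ → Set
        New n = rank (e n) ≡ n

        new? : ∀ n → Dec (New n)
        new? n = rank (e n) ℕ.≟ n

        rank-new : ∀ x → New (rank x)
        rank-new x = rank-unique (proj₁ (proj₂ (index x)))

        count : ℕ → ℕ
        count zero    = zero
        count (suc n) = if does (new? n) then suc (count n) else count n

        count-new : ∀ {n} → New n → count (suc n) ≡ suc (count n)
        count-new {n} new = cong (if_then suc (count n) else count n) (dec-true (new? n) new)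

        count-old : ∀ {n} → ¬ New n → count (suc n) ≡ count n
        count-old {n} ¬new = cong (if_then suc (count n) else count n) (dec-false (new? n) ¬new)

        count-step : ∀ n → count n ℕ.≤ count (suc n)
        count-step n = if-≤ (does (new? n))
          where
          if-≤ : ∀ b {k} → k ℕ.≤ (if b then suc k else k)
          if-≤ true  = ℕ.n≤1+n _
          if-≤ false = ℕ.≤-refl

        count-mono : ∀ {m n} → m ℕ.≤′ n → count m ℕ.≤ count n
        count-mono (ℕ.≤′-reflexive refl) = ℕ.≤-refl
        count-mono (ℕ.≤′-step m≤n)       = ℕ.≤-trans (count-mono m≤n) (count-step _)

        count-< : ∀ {m n} → New m → m ℕ.< n → count m ℕ.< count n
        count-< {n = n} new m<n =
          subst (ℕ._≤ count n) (count-new new) (count-mono {suc _} {n} (ℕ.≤⇒≤′ m<n))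

        count-injective : ∀ {m n} → New m → New n → count m ≡ count n → m ≡ n
        count-injective {m} {n} new new′ h with ℕ.<-cmp m n
        ... | tri< l _ _ = ⊥-elim (ℕ.<⇒≢ (count-< new l) h)
        ... | tri≈ _ k _ = k
        ... | tri> _ _ l = ⊥-elim (ℕ.<⇒≢ (count-< new′ l) (sym h))

        -- Otherwise every rank would be below `N`, because ranks are new. By the pigeonhole
        -- principle two of the first `suc N` values of `g` would have equal ranks and so be equal.
        later-new : ∀ N → ∃[ d ] New (d ℕ.+ N)
        later-new N with em₀ {∃[ d ] New (d ℕ.+ N)}
        ... | yes h = h
        ... | no ¬h =
          let (i , j , i<j , h) = pigeonhole (ℕ.n<1+n N) (λ i → fromℕ< (bound (g (toℕ i))))
          in ⊥-elim (ℕ.<⇒≢ i<j (g-injective (same (fromℕ<-injective _ _ _ _ h))))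
          where
          bound : ∀ x → rank x ℕ.< N
          bound x with rank x ℕ.<? N
          ... | yes l = l
          ... | no ¬l = ⊥-elim (¬h (rank x ℕ.∸ N ,
            subst New (sym (ℕ.m∸n+n≡m (ℕ.≮⇒≥ ¬l))) (rank-new x)))

          same : ∀ {x y} → rank x ≡ rank y → x ≈ y
          same {x} {y} h = Setoid.trans S (Setoid.sym S (proj₁ (proj₂ (index x))))
            (subst (λ n → e n ≈ y) (sym h) (proj₁ (proj₂ (index y))))

        -- Recursion on the distance to a known new index, stopping at the first one met; the
        -- indices skipped leave `count` unchanged.
        next-new : ∀ d N → New (d ℕ.+ N) → ∃[ n ] New n × count n ≡ count N
        next-new zero    N new = N , new , refl
        next-new (suc d) N new with new? N
        ... | yes h = N , h , refl
        ... | no ¬h =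
          let (n , new′ , h) = next-new d (suc N) (subst New (sym (ℕ.+-suc d N)) new)
          in n , new′ , trans h (count-old ¬h)

        nth : ∀ k → ∃[ n ] New n × count n ≡ k
        nth zero    = let (d , new) = later-new 0 in next-new d 0 new
        nth (suc k) =
          let (n , new , h)  = nth k
              (d , new′)     = later-new (suc n)
              (m , new″ , l) = next-new d (suc n) new′
          in m , new″ , trans l (trans (count-new new) (cong suc h))

      -- An element is sent to the number of first occurrences in `e` before its own. The injection
      -- `g` makes first occurrences infinite in number, so every natural number is attained.
      countable : Inverse S ⟦ ω ⟧
      countable = record
        { to        = λ x → count (rank x)
        ; from      = λ k → e (proj₁ (nth k))
        ; to-cong   = λ x≈y → ≡⇒≐ (cong count (rank-unique x≈y))
        ; from-cong = λ h → reflexive (cong (λ k → e (proj₁ (nth k))) (num-injective h))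
        ; inverse   =
            (λ {k} {x} x≈ → let (n , new , h) = nth k in
              ≡⇒≐ (trans (cong count (trans (rank-unique x≈) new)) h))
          , (λ {x} {k} h → let (n , new , l) = nth k in
              Setoid.trans S
                (reflexive (cong e (count-injective new (rank-new x) (trans l (num-injective h)))))
                (proj₁ (proj₂ (index x))))
        }
        where
        ≡⇒≐ : ∀ {m n} → m ≡ n → num m ≐ num n
        ≡⇒≐ {m} refl = ≐-refl (num m)

  module _ {M : V} (inv : Inverse ⟦ M ⟧ ⟦ ω ⟧) where
    open Inverse inv

    enumerate : ℕ → Idx M
    enumerate = Inverse.from inv

    enumerate-surjective : ∀ i → ∃[ n ] el M (enumerate n) ≐ el M i
    enumerate-surjective i = Inverse.to inv i , strictlyInverseʳ i

    enumerate-injective : ∀ {m n} → el M (enumerate m) ≐ el M (enumerate n) → m ≡ n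
    enumerate-injective {m} {n} h = num-injective
      (≐-trans (num m) _ (num n) (≐-sym _ (num m) (strictlyInverseˡ m))
        (≐-trans _ _ (num n) (to-cong h) (strictlyInverseˡ n)))

  -- Clubs of sets closed under countably many operations

  module ClosureClub {A : V → Set} (A-resp : A Respects _≐_)
    {K : Set} (key : K → V) (val : K → ℕ → V) (val∈A : ∀ k n → A (val k n))
    (a₀ : V) (a₀∈A : A a₀) where

    -- Uncountably many `k` may share a key, so closure is asked only for one representative `k′` of
    -- each key.
    Closed : V → Set₁
    Closed M = [ A ]^ℵ₀ M × a₀ ∈ M ×
      (∀ k → key k ∈ M → ∃[ k′ ] key k′ ≐ key k × (∀ n → val k′ n ∈ M))

    respects : Closed Respects _≐_
    respects {M} {M′} M≐M′ ((M⊆A , inv) , a₀∈M , closed) =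
        ((λ x m → M⊆A x (∈-respʳ M′≐M m)) , countable ⟦ M′ ⟧
          (λ n → move (enumerate {M} inv n))
          (λ x → let (n , h) = enumerate-surjective {M} inv (back x) in
            n , ≐-trans (el M′ (move (enumerate {M} inv n))) _ _
                  (≐-sym _ _ (move-≐ (enumerate {M} inv n)))
                  (≐-trans _ _ _ h (≐-sym _ _ (back-≐ x))))
          (λ n → move (enumerate {M} inv n))
          (λ {m} {n} h → enumerate-injective {M} inv
            (≐-trans _ _ _ (move-≐ (enumerate {M} inv m))
              (≐-trans _ _ _ h (≐-sym _ _ (move-≐ (enumerate {M} inv n)))))))
      , ∈-respʳ M≐M′ a₀∈M
      , λ k m → let (k′ , e , h) = closed k (∈-respʳ M′≐M m) in
                k′ , e , λ n → ∈-respʳ M≐M′ (h n)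
      where
      M′≐M = ≐-sym M M′ M≐M′

      move : Idx M → Idx M′
      move i = proj₁ (∈-respʳ M≐M′ (el∈ M i))

      move-≐ : ∀ i → el M i ≐ el M′ (move i)
      move-≐ i = proj₂ (∈-respʳ M≐M′ (el∈ M i))

      back : Idx M′ → Idx M
      back i = proj₁ (∈-respʳ M′≐M (el∈ M′ i))

      back-≐ : ∀ i → el M′ i ≐ el M (back i)
      back-≐ i = proj₂ (∈-respʳ M′≐M (el∈ M′ i))

    -- Excluded middle fixes one `k` for each `x`. Where there is none, the value is `a₀`, which
    -- every closed set contains.
    step : V → ℕ → V
    step x n with em₀ {∃[ k ] key k ≐ x}
    ... | yes (k , _) = val k n
    ... | no _        = a₀

    step∈A : ∀ x n → A (step x n)
    step∈A x n with em₀ {∃[ k ] key k ≐ x}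
    ... | yes (k , _) = val∈A k n
    ... | no _        = a₀∈A

    step-val : ∀ {k} x → key k ≐ x → ∃[ k′ ] key k′ ≐ x × (∀ n → val k′ n ≡ step x n)
    step-val {k} x h with em₀ {∃[ k ] key k ≐ x}
    ... | yes (k′ , h′) = k′ , h′ , λ _ → refl
    ... | no ¬h         = ⊥-elim (¬h (k , h))

    unbounded : ∀ a → [ A ]^ℵ₀ a → ∃[ M ] Closed M × a ⊆ M
    unbounded a (a⊆A , inv) = M ,
        -- The infinite set `a` occupies stage `0` from position one on, after `a₀`, and provides
        -- the injection.
        ( ( M⊆A , countable ⟦ M ⟧ id (λ n → n , ≐-refl (el M n)) (λ n → ⌜ 0 , suc n ⌝)
              (λ {m} {n} h → enumerate-injective {a} inv (≐-trans _ _ _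
                (stage-≐ 0 (suc m)) (≐-trans _ _ _ h (≐-sym _ _ (stage-≐ 0 (suc n)))))))
        , stage∈M 0 0
        , λ k (i , h) →
            let (m , l) = unpair i
                (k′ , h′ , vals) = step-val {k} (stage m l) h
            in k′ , ≐-trans _ _ _ h′ (≐-sym (key k) (stage m l) h) , λ n →
               subst (_∈ M) (trans
                 (cong (λ (x , y) → step (stage m x) y) (unpair-pair l n))
                 (sym (vals n))) (stage∈M (suc m) ⌜ l , n ⌝))
      , λ z (i , h) → let (n , h′) = enumerate-surjective {a} inv i in
          ∈-respˡ {z = M} (≐-trans _ _ _ h′ (≐-sym z (el a i) h)) (stage∈M 0 (suc n))
      where
      stage : ℕ → ℕ → V
      stage zero    zero    = a₀
      stage zero    (suc n) = el a (enumerate {a} inv n)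
      -- Each stage lists all values of `step` on the previous one, with position and argument coded
      -- in one number. Thus the union `M` of the stages is closed.
      stage (suc m) n       = step (stage m (proj₁ (unpair n))) (proj₂ (unpair n))

      M : V
      M = sup ℕ (λ n → stage (proj₁ (unpair n)) (proj₂ (unpair n)))

      stage∈A : ∀ m n → A (stage m n)
      stage∈A zero    zero    = a₀∈A
      stage∈A zero    (suc n) = a⊆A _ (el∈ a (enumerate {a} inv n))
      stage∈A (suc m) n       = step∈A (stage m (proj₁ (unpair n))) (proj₂ (unpair n))

      M⊆A : ∀ x → x ∈ M → A x
      M⊆A x (n , h) = A-resp (≐-sym x (el M n) h) (stage∈A (proj₁ (unpair n)) (proj₂ (unpair n)))

      stage-≐ : ∀ m n → stage m n ≐ el M ⌜ m , n ⌝
      stage-≐ m n = subst (λ (x , y) → stage m n ≐ stage x y) (sym (unpair-pair m n))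
                      (≐-refl (stage m n))

      stage∈M : ∀ m n → stage m n ∈ M
      stage∈M m n = ⌜ m , n ⌝ , stage-≐ m n

    closed : (M : ℕ → V) → (∀ k → Closed (M k)) → Closed (⋃ (sup ℕ M))
    closed M c =
        ( (λ x ((m , i) , h) → proj₁ (proj₁ (c m)) x (i , h))
        , countable ⟦ ⋃ (sup ℕ M) ⟧
            (λ n → proj₁ (unpair n) , enum (proj₁ (unpair n)) (proj₂ (unpair n)))
            (λ (m , i) → let (n , h) = enumerate-surjective {M m} (inv m) i in
              ⌜ m , n ⌝ ,
              subst (λ (x , y) → el (M x) (enum x y) ≐ el (M m) i) (sym (unpair-pair m n)) h)
            (λ n → 0 , enum 0 n)
            (enumerate-injective {M 0} (inv 0)))
      , ∈⋃ 0 (proj₁ (proj₂ (c 0)))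
      , λ k ((m , i) , h) → let (k′ , h′ , vals) = proj₂ (proj₂ (c m)) k (i , h) in
          k′ , h′ , λ n → ∈⋃ m (vals n)
      where
      inv : ∀ m → Inverse ⟦ M m ⟧ ⟦ ω ⟧
      inv m = proj₂ (proj₁ (c m))

      enum : ∀ m → ℕ → Idx (M m)
      enum m = enumerate {M m} (inv m)

      ∈⋃ : ∀ m {x} → x ∈ M m → x ∈ ⋃ (sup ℕ M)
      ∈⋃ m (i , h) = (m , i) , h

    isClub : IsClub A Closed
    isClub = record
      { respects  = λ {M} {M′} → respects {M} {M′}
      ; countable = λ M → proj₁
      ; unbounded = unbounded
      ; closed    = λ M c _ → closed M c
      }

  -- Preservation

  ⊆⇒≼ : ∀ {x y} → x ⊆ y → x ≼ y
  ⊆⇒≼ {x} {y} x⊆y = record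
    { to        = to′
    ; cong      = λ {i} {j} e → ≐-trans (el y (to′ i)) (el x i) (el y (to′ j))
                    (≐-sym (el x i) _ (to-≐ i)) (≐-trans (el x i) (el x j) _ e (to-≐ j))
    ; injective = λ {i} {j} e → ≐-trans (el x i) (el y (to′ i)) (el x j) (to-≐ i)
                    (≐-trans (el y (to′ i)) (el y (to′ j)) _ e (≐-sym (el x j) _ (to-≐ j)))
    }
    where
    to′ : Idx x → Idx y
    to′ i = proj₁ (x⊆y (el x i) (el∈ x i))

    to-≐ : ∀ i → el x i ≐ el y (to′ i)
    to-≐ i = proj₂ (x⊆y (el x i) (el∈ x i))

  H-⊆ : ∀ {θ x y} → trcl x ⊆ trcl y → H θ y → H θ x
  H-⊆ {θ} {x} {y} x⊆y (y≼θ , θ⋠y) =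
      Compose.injection x≼y y≼θ , λ θ≼x → θ⋠y (Compose.injection θ≼x x≼y)
    where
    x≼y : trcl x ≼ trcl y
    x≼y = ⊆⇒≼ {trcl x} {trcl y} x⊆y

  trcl-el : ∀ x i → trcl (el x i) ⊆ trcl x
  trcl-el (sup A f) a z (j , e) = inj₂ (a , j) , e

  trcl-cong : ∀ x y → x ≐ y → trcl x ⊆ trcl y
  trcl-cong (sup A f) (sup B g) (l , r) z (inj₁ a , e) =
    let (b , h) = l a in inj₁ b , ≐-trans z (f a) (g b) e h
  trcl-cong (sup A f) (sup B g) (l , r) z (inj₂ (a , j) , e) =
    let (b , h) = l a
        (k , e′) = trcl-cong (f a) (g b) h z (j , e)
    in inj₂ (b , k) , e′

  H-resp : ∀ θ → H θ Respects _≐_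
  H-resp θ {x} {y} x≐y = H-⊆ {θ} {y} {x} (trcl-cong y x (≐-sym x y x≐y))

  H-el : ∀ θ x i → H θ x → H θ (el x i)
  H-el θ x i = H-⊆ {θ} {el x i} {x} (trcl-el x i)

  -- The strongly generic condition and the forced selector

  module Preservation (θ X τ : V) (ℙ : PosetV) (rothberger : IsRothberger X τ)
    (ℙ∈H : H θ (PosetV.asSet ℙ))
    (stationary : IsStationary (H θ) (IsStronglyProperModel θ ℙ)) where

    open Names ℙ using (model; mixing; ⊩⇒forces)
    open Semantics model
    open Forcing ℙ using (∣P∣; cond; isPartialOrder)

    cond∈H : ∀ p → H θ (cond p)
    -- The indices `true` lead from the Kuratowski pair `⟨ ∣P∣ , leq ⟩` through `｛ ∣P∣ , ∣P∣ ｝` to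
    -- `∣P∣`.
    cond∈H p = H-el θ ∣P∣ p (H-el θ ｛ ∣P∣ , ∣P∣ ｝ true (H-el θ (PosetV.asSet ℙ) true ℙ∈H))

    selector-below : ∀ {p t w s} → TopologyWithBasis t (check X) (check τ) p → eq p w ω̇ →
      CoverSequence s w (check X) t p →
      ∃[ q ] q ≤ p × ∃[ f ] CoveringSelector f s w (check X) q
    selector-below {p} {t} {w} {s} basis w≈ω sequence =
      p′ , p′≤p , covering-selector σ p′≤p predense
      where
      open GenericSelection.Selector model mixing rothberger basis w≈ω sequence

      -- The sets in this club contain `p`, so that a strongly generic `p′` can be found below it,
      -- and are closed under the answers.
      open ClosureClub (λ {x} {y} → H-resp θ {x} {y})
        (λ (σ : Start) → cond (proj₁ σ)) (λ σ n → cond (answer σ n))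
        (λ σ n → cond∈H (answer σ n)) (cond p) (cond∈H p)

      found : ∃[ M ] Closed M × IsStronglyProperModel θ ℙ M
      found = stationary Closed isClub

      M : V
      M = proj₁ found

      closedM : Closed M
      closedM = proj₁ (proj₂ found)

      inv : Inverse ⟦ M ⟧ ⟦ ω ⟧
      inv = proj₂ (proj₁ closedM)

      generic : ∃[ p′ ] p′ ≤ p × Forcing.IsStronglyGeneric ℙ M p′
      generic = proj₂ (proj₂ (proj₂ (proj₂ (proj₂ found)))) p (proj₁ (proj₂ closedM))

      p′ : Cond
      p′ = proj₁ generic

      p′≤p : p′ ≤ p
      p′≤p = proj₁ (proj₂ generic)

      Coded : ℕ → Start → Set
      Coded i σ = cond (proj₁ σ) ≐ el M (enumerate {M} inv i) × (∀ n → cond (answer σ n) ∈ M)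

      decodeIndex : ∀ i → Dec (∃ (Coded i)) → Start
      decodeIndex i (yes (σ , _)) = σ
      -- A default for elements of `M` that code no suitable start; the index produced in `predense`
      -- is never of this kind.
      decodeIndex i (no _)        = p , p , ≤-refl , ≤-refl

      σ : ℕ → Start
      σ i = decodeIndex i em₀

      σ-coded : ∀ i → ∃ (Coded i) → Coded i (σ i)
      σ-coded i h = go em₀
        where
        go : (d : Dec (∃ (Coded i))) → Coded i (decodeIndex i d)
        go (yes (_ , c)) = c
        go (no ¬h)       = ⊥-elim (¬h h)

      predense : ∀ {q} → q ≤ p′ → ∃[ i ] (∀ n → Compatible q (answer (σ i) n))
      predense {q} q≤p′ =
        let (q̄ , q̄∈M@(j , q̄≐) , residue) = proj₂ (proj₂ generic) q q≤p′
            -- Taking `q̄` itself as the extension in `M` shows it compatible with `q`, hence with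
            -- `p`, so `q̄` is a start.
            (c , c≤q̄ , c≤q)       = residue q̄ ≤-refl q̄∈M
            start                  = q̄ , c , c≤q̄ , ≤-trans c≤q (≤-trans q≤p′ p′≤p)
            -- Closure may replace the start by another one with the same condition as a set; the
            -- answers of that one lie in `M`.
            (σ′ , e , vals)        = proj₂ (proj₂ closedM) start q̄∈M
            (i , h)                = enumerate-surjective {M} inv j
            h′                     = ≐-sym _ _ (≐-trans _ _ _ h (≐-sym _ _ q̄≐))
            (coded , inM)          = σ-coded i (σ′ , ≐-trans _ _ _ e h′ , vals)
        in i , λ n →
           -- The answer belongs to `M` and lies below the condition of `σ i`, which equals `q̄` as
           -- a set, so the residue applies.
           let (d , d≤ , d≤q) = residue (answer (σ i) n)
                 (≤-trans (answer≤ (σ i) n)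
                   (IsPartialOrder.reflexive isPartialOrder
                     (≐-trans _ _ _ coded (≐-sym _ _ h′))))
                 (inM n)
           in d , d≤q , d≤

    forces-rothberger : Forcing.ForcesRothberger ℙ X τ
    forces-rothberger p = ⊩⇒forces (isRothbergerWithBasis′ (# 0) (# 1)) {ρ = ρ}
      (encode (isRothbergerWithBasisᵐ {x = # 0} {b = # 1} {ρ = ρ})
        -- A selector has to exist densely, so the hypotheses are restricted to an arbitrary `q′`
        -- and `selector-below` is used there in place of `p`.
        λ t q≤p basis w r≤q w≈ω s r′≤r sequence q′ q′≤r′ → selector-below
          (topologyWithBasis-mono (≤-trans q′≤r′ (≤-trans r′≤r r≤q)) basis)
          (eq-mono (≤-trans q′≤r′ r′≤r) w≈ω)
          (coverSequence-mono q′≤r′ sequence))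
      where
      ρ = check X ∷ check τ ∷ []

theorem5p6 : ExcludedMiddle (lsuc 0ℓ) → AxiomOfChoice →
    ∀ (θ X τ : V) (ℙ : PosetV) →
    IsRegular θ → IsLargeEnough θ X τ ℙ →
    IsTopology X τ → H θ ⟨ X , τ ⟩ → IsRothberger X τ →
    H θ (PosetV.asSet ℙ) →
    IsStationary (H θ) (IsStronglyProperModel θ ℙ) →
    Forcing.ForcesRothberger ℙ X τ
theorem5p6 em _ θ X τ ℙ _ _ _ _ rothberger ℙ∈H stationary =
  Classical.Preservation.forces-rothberger em θ X τ ℙ rothberger ℙ∈H stationary
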